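{- The problem of deciding validity of entailment problems $(\phi,\psi,\mathcal{R})$ that are progressing, left-connected and established (i.e. $\mathcal{R}$ is progressing for both $\phi$ and $\psi$, connected for $\phi$, and established for both $\phi$ and $\psi$) is undecidable.
   Context: Separation Logic setting. Fix a natural number $\kappa$, a countably infinite set $\mathsf{V}$ of variables, a special constant $\bot$, and predicate symbols with arities. Formulas: $\phi ::= x \not\approx x' \mid x \approx x' \mid x \mapsto (y_1,\dots,y_\kappa) \mid p(x_1,\dots,x_n) \mid \phi_1 * \phi_2 \mid \phi_1 \vee \phi_2 \mid \exists x.\phi_1$, with $x,x',x_i\in\mathsf{V}$, $y_i\in\mathsf{V}\cup\{\bot\}$. A symbolic heap is $\exists\mathbf{x}.\,\alpha_1*\dots*\alpha_m$ with atoms $\alpha_i$. An SID is a finite set $\mathcal{R}$ of rules $p(x_1,\dots,x_n)\Leftarrow\pi$, $x_i$ pairwise distinct, $\pi$ a quantifier-free symbolic heap; existential variables of the rule are those of $\mathrm{fv}(\pi)\setminus\{x_1,\dots,x_n\}$. $p\succeq q$ iff a rule for $p$ contains $q$; $\mathcal{P}(\phi)$ is the set of $q$ with $p\succeq^* q$ for some $p$ in $\phi$. Unfolding: $\phi\Leftarrow_{\mathcal{R}}\psi$ if $\psi$ is obtained by replacing an atom $p(u_1,\dots,u_n)$ of $\phi$ by $\pi[x_i/u_i]$ for a rule $p(x_1,\dots,x_n)\Leftarrow\pi$ (existentials renamed fresh); an unfolding is any $\psi$ with $\phi\Leftarrow^*_{\mathcal{R}}\psi$. A variable $x$ is allocated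 by a symbolic heap if it contains equalities $x=x_1\approx x_2\approx\dots\approx x_n$ ($n\ge1$) and an atom $x_n\mapsto(\dots)$. Semantics (stores $s:\mathsf{V}\cup\{\bot\}\rightharpoonup\mathcal{L}$ with $s(x)=\underline{\bot}$ iff $x=\bot$, finite heaps $\mathcal{L}\rightharpoonup\mathcal{L}^\kappa$ not allocating $\underline{\bot}$, standard separating-conjunction semantics with predicate atoms interpreted as the least fixpoint of the rules); $(\phi,\psi,\mathcal{R})$ is valid iff every model of $\phi$ is a model of $\psi$. A rule $p(x_1,\dots,x_n)\Leftarrow\pi$ is progressing iff $\pi=x_1\mapsto(y_1,\dots,y_\kappa)*\rho$ with no points-to atom in $\rho$; connected iff it is progressing and every predicate atom in $\rho$ has the form $q(y_i,\mathbf{u})$ for some $i\in\{1,\dots,\kappa\}$; established iff every existential variable of the rule is allocated by every predicate-less unfolding of $\pi$. $\mathcal{R}$ is progressing (connected, established) for $\phi$ iff every rule with head predicate in $\mathcal{P}(\phi)$ is so. An entailment problem $(\phi,\psi,\mathcal{R})$ is left- (right-) progressing/connected/established iff $\mathcal{R}$ has that property for $\phi$ (for $\psi$), and progressing/connected/established iff both left and right. -}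

module Defs where

open import Data.Nat using (ℕ; zero; suc; _+_; _*_; _^_; _≤_; _≡ᵇ_)
open import Data.Bool using (if_then_else_)
open import Data.Fin using (Fin)
open import Data.Maybe using (Maybe; just; nothing)
open import Data.List using (List; []; _∷_; _++_; length; map; concatMap)
open import Data.List.Membership.Propositional using (_∈_; _∉_)
open import Data.List.Relation.Unary.All using (All)
open import Data.List.Relation.Unary.Unique.Propositional using (Unique)
open import Data.List.Relation.Binary.Pointwise using (Pointwise)
open import Data.Vec using (Vec; toList; lookup) renaming ([] to []ᵥ; _∷_ to _∷ᵥ_; map to mapᵥ)
open import Data.Product using (Σ; _×_; _,_)
open import Data.Sum using (_⊎_)
open import Data.Unit using (⊤)
open import Data.Empty using (⊥)
open import Relation.Nullary using (¬_)
open import Relation.Binary.PropositionalEquality using (_≡_; _≢_)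
open import Relation.Binary.Construct.Closure.ReflexiveTransitive using (Star)

Var : Set
Var = ℕ

record PredSym : Set where
  constructor psym
  field
    name  : ℕ
    arity : ℕ

data VT : Set where
  var : Var → VT
  ⊥ᵥ  : VT

module _ (κ : ℕ) where

  data Atom : Set where
    _≉_  : Var → Var → Atom
    _≈_  : Var → Var → Atom
    _↦_  : Var → Vec VT κ → Atom
    pred : PredSym → List Var → Atom

  data Form : Set where
    atom : Atom → Form
    _∗_  : Form → Form → Form
    _∨_  : Form → Form → Form
    ex   : Var → Form → Form

  -- A rule  head(params) ⇐ body,  body a quantifier-free symbolic heap
  -- (a list of atoms, read as their separating conjunction).
  record Rule : Set where
    constructor rule
    field
      head   : PredSym
      params : List Var
      body   : List Atom

  SID : Set
  SID = List Rule

  record Problem : Set where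
    constructor problem
    field
      lhs : Form
      rhs : Form
      sid : SID

-- Semantics.  Locations: Maybe ℕ, with ⊥̲ = nothing (so 𝓛 is countably
-- infinite).  Stores map every variable to a non-⊥̲ location (an ℕ);
-- heaps are finite partial maps ℕ ⇀ 𝓛^κ (so ⊥̲ is never allocated).

Loc : Set
Loc = Maybe ℕ

Store : Set
Store = Var → ℕ

⟦_⟧ : VT → Store → Loc
⟦ var x ⟧ s = just (s x)
⟦ ⊥ᵥ ⟧ s = nothing

update : Store → Var → ℕ → Store
update s x v y = if y ≡ᵇ x then v else s y

module _ (κ : ℕ) where

  record Heap : Set where
    field
      cell   : ℕ → Maybe (Vec Loc κ)
      finite : Σ ℕ λ b → ∀ l → b ≤ l → cell l ≡ nothing
  open Heap public

  EmptyHeap : Heap → Set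
  EmptyHeap h = ∀ l → cell h l ≡ nothing

  Split : Heap → Heap → Heap → Set
  Split h h₁ h₂ = ∀ l → (cell h₁ l ≡ nothing × cell h l ≡ cell h₂ l)
                      ⊎ (cell h₂ l ≡ nothing × cell h l ≡ cell h₁ l)

module _ (κ : ℕ) (R : SID κ) where
  open Rule

  -- Satisfaction; predicate atoms get the least-fixpoint semantics
  -- (inductive definition).  Existential variables of a rule are
  -- interpreted by the arbitrary store s' agreeing with the parameters.
  mutual
    data SatA : Store → Heap κ → Atom κ → Set where
      sat≉ : ∀ {s h x y} → s x ≢ s y → EmptyHeap κ h → SatA s h (x ≉ y)
      sat≈ : ∀ {s h x y} → s x ≡ s y → EmptyHeap κ h → SatA s h (x ≈ y)
      sat↦ : ∀ {s h x ys} →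
             cell h (s x) ≡ just (mapᵥ (λ y → ⟦ y ⟧ s) ys) →
             (∀ l → l ≢ s x → cell h l ≡ nothing) →
             SatA s h (x ↦ ys)
      satP : ∀ {s h p us} (r : Rule κ) → r ∈ R → head r ≡ p →
             (s' : Store) → Pointwise (λ x u → s' x ≡ s u) (params r) us →
             SatL s' h (body r) → SatA s h (pred p us)

    data SatL : Store → Heap κ → List (Atom κ) → Set where
      sat[] : ∀ {s h} → EmptyHeap κ h → SatL s h []
      sat∷  : ∀ {s h a as} (h₁ h₂ : Heap κ) → Split κ h h₁ h₂ →
              SatA s h₁ a → SatL s h₂ as → SatL s h (a ∷ as)

  data Sat : Store → Heap κ → Form κ → Set where
    satAtom : ∀ {s h a} → SatA s h a → Sat s h (atom a)
    sat∗    : ∀ {s h φ ψ} (h₁ h₂ : Heap κ) → Split κ h h₁ h₂ →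
              Sat s h₁ φ → Sat s h₂ ψ → Sat s h (φ ∗ ψ)
    sat∨₁   : ∀ {s h φ ψ} → Sat s h φ → Sat s h (φ ∨ ψ)
    sat∨₂   : ∀ {s h φ ψ} → Sat s h ψ → Sat s h (φ ∨ ψ)
    satEx   : ∀ {s h x φ} (v : ℕ) → Sat (update s x v) h φ → Sat s h (ex x φ)

module _ (κ : ℕ) where
  open Rule
  open Problem

  Valid : Problem κ → Set
  Valid P = ∀ (s : Store) (h : Heap κ) → Sat κ (sid P) s h (lhs P) → Sat κ (sid P) s h (rhs P)

  vtVars : List VT → List Var
  vtVars [] = []
  vtVars (var x ∷ ys) = x ∷ vtVars ys
  vtVars (⊥ᵥ ∷ ys) = vtVars ys

  atomVars : Atom κ → List Var
  atomVars (x ≉ y) = x ∷ y ∷ []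
  atomVars (x ≈ y) = x ∷ y ∷ []
  atomVars (x ↦ ys) = x ∷ vtVars (toList ys)
  atomVars (pred p us) = us

  listVars : List (Atom κ) → List Var
  listVars = concatMap atomVars

  renameVT : (Var → Var) → VT → VT
  renameVT σ (var x) = var (σ x)
  renameVT σ ⊥ᵥ = ⊥ᵥ

  renameA : (Var → Var) → Atom κ → Atom κ
  renameA σ (x ≉ y) = σ x ≉ σ y
  renameA σ (x ≈ y) = σ x ≈ σ y
  renameA σ (x ↦ ys) = σ x ↦ mapᵥ (renameVT σ) ys
  renameA σ (pred p us) = pred p (map σ us)

  ExVar : Rule κ → Var → Set
  ExVar r z = z ∈ listVars (body r) × z ∉ params r

  NotPred : Atom κ → Set
  NotPred (pred _ _) = ⊥
  NotPred _ = ⊤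

  NotPto : Atom κ → Set
  NotPto (_ ↦ _) = ⊥
  NotPto _ = ⊤

  data Unfold1 (R : SID κ) : List (Atom κ) → List (Atom κ) → Set where
    unfold : ∀ (pre post : List (Atom κ)) (p : PredSym) (us : List Var)
               (r : Rule κ) → r ∈ R → head r ≡ p →
               (σ : Var → Var) →
               Pointwise (λ x u → σ x ≡ u) (params r) us →
               (∀ z → ExVar r z → σ z ∉ listVars (pre ++ pred p us ∷ post)) →
               (∀ z z' → ExVar r z → ExVar r z' → σ z ≡ σ z' → z ≡ z') →
               Unfold1 R (pre ++ pred p us ∷ post)
                         (pre ++ map (renameA σ) (body r) ++ post)

  Unfolding : SID κ → List (Atom κ) → List (Atom κ) → Set
  Unfolding R = Star (Unfold1 R)

  data EqChain (as : List (Atom κ)) : Var → Var → Set where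
    here   : ∀ {x} → EqChain as x x
    stepR  : ∀ {x z y} → (x ≈ z) ∈ as → EqChain as z y → EqChain as x y
    stepL  : ∀ {x z y} → (z ≈ x) ∈ as → EqChain as z y → EqChain as x y

  Allocated : List (Atom κ) → Var → Set
  Allocated as x = Σ Var λ y → EqChain as x y × Σ (Vec VT κ) λ ys → (y ↦ ys) ∈ as

  Progressing : Rule κ → Set
  Progressing r = Σ Var λ x → Σ (List Var) λ rest → Σ (Vec VT κ) λ ys →
    Σ (List (Atom κ)) λ ρ₁ → Σ (List (Atom κ)) λ ρ₂ →
      params r ≡ x ∷ rest × body r ≡ ρ₁ ++ (x ↦ ys) ∷ ρ₂ × All NotPto (ρ₁ ++ ρ₂)

  ConnAtom : Vec VT κ → Atom κ → Set
  ConnAtom ys (pred q us) = Σ Var λ z → Σ (List Var) λ rest → us ≡ z ∷ rest × var z ∈ toList ys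
  ConnAtom ys _ = ⊤

  Connected : Rule κ → Set
  Connected r = Σ Var λ x → Σ (List Var) λ rest → Σ (Vec VT κ) λ ys →
    Σ (List (Atom κ)) λ ρ₁ → Σ (List (Atom κ)) λ ρ₂ →
      params r ≡ x ∷ rest × body r ≡ ρ₁ ++ (x ↦ ys) ∷ ρ₂ × All NotPto (ρ₁ ++ ρ₂)
      × All (ConnAtom ys) (ρ₁ ++ ρ₂)

  Established : SID κ → Rule κ → Set
  Established R r = ∀ z → ExVar r z → ∀ bs → Unfolding R (body r) bs →
                    All NotPred bs → Allocated bs z

  predsA : Atom κ → List PredSym
  predsA (pred p _) = p ∷ []
  predsA _ = []

  predsF : Form κ → List PredSym
  predsF (atom a) = predsA a
  predsF (φ ∗ ψ) = predsF φ ++ predsF ψ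
  predsF (φ ∨ ψ) = predsF φ ++ predsF ψ
  predsF (ex _ φ) = predsF φ

  data InP (R : SID κ) (φ : Form κ) : PredSym → Set where
    base : ∀ {q} → q ∈ predsF φ → InP R φ q
    step : ∀ {p q} (r : Rule κ) → InP R φ p → r ∈ R → head r ≡ p →
           q ∈ concatMap predsA (body r) → InP R φ q

  For : (Rule κ → Set) → SID κ → Form κ → Set
  For Prop R φ = ∀ r → r ∈ R → InP R φ (head r) → Prop r

  WFAtom : Atom κ → Set
  WFAtom (pred p us) = length us ≡ PredSym.arity p
  WFAtom _ = ⊤

  WFForm : Form κ → Set
  WFForm (atom a) = WFAtom a
  WFForm (φ ∗ ψ) = WFForm φ × WFForm ψ
  WFForm (φ ∨ ψ) = WFForm φ × WFForm ψ
  WFForm (ex _ φ) = WFForm φ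

  WFRule : Rule κ → Set
  WFRule r = Unique (params r) × length (params r) ≡ PredSym.arity (head r)
             × All WFAtom (body r)

  WellFormed : Problem κ → Set
  WellFormed P = All WFRule (sid P) × WFForm (lhs P) × WFForm (rhs P)

  InFragment : Problem κ → Set
  InFragment P =
    WellFormed P
    × For Progressing (sid P) (lhs P) × For Progressing (sid P) (rhs P)
    × For Connected (sid P) (lhs P)
    × For (Established (sid P)) (sid P) (lhs P)
    × For (Established (sid P)) (sid P) (rhs P)

⟪_,_⟫ : ℕ → ℕ → ℕ
⟪ a , b ⟫ = 2 ^ a * suc (2 * b)

encℕs : List ℕ → ℕ
encℕs [] = 0
encℕs (x ∷ xs) = suc ⟪ x , encℕs xs ⟫

encVT : VT → ℕ
encVT (var x) = suc x
encVT ⊥ᵥ = 0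

encPS : PredSym → ℕ
encPS (psym n a) = ⟪ n , a ⟫

module _ (κ : ℕ) where
  open Rule
  open Problem

  encAtom : Atom κ → ℕ
  encAtom (x ≉ y) = ⟪ 0 , ⟪ x , y ⟫ ⟫
  encAtom (x ≈ y) = ⟪ 1 , ⟪ x , y ⟫ ⟫
  encAtom (x ↦ ys) = ⟪ 2 , ⟪ x , encℕs (map encVT (toList ys)) ⟫ ⟫
  encAtom (pred p us) = ⟪ 3 , ⟪ encPS p , encℕs us ⟫ ⟫

  encForm : Form κ → ℕ
  encForm (atom a) = ⟪ 0 , encAtom a ⟫
  encForm (φ ∗ ψ) = ⟪ 1 , ⟪ encForm φ , encForm ψ ⟫ ⟫
  encForm (φ ∨ ψ) = ⟪ 2 , ⟪ encForm φ , encForm ψ ⟫ ⟫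
  encForm (ex x φ) = ⟪ 3 , ⟪ x , encForm φ ⟫ ⟫

  encRule : Rule κ → ℕ
  encRule r = ⟪ encPS (head r) , ⟪ encℕs (params r) , encℕs (map encAtom (body r)) ⟫ ⟫

  encProblem : Problem κ → ℕ
  encProblem P = ⟪ encForm (lhs P) , ⟪ encForm (rhs P) , encℕs (map encRule (sid P)) ⟫ ⟫

data PR : ℕ → Set where
  zeroᶠ : ∀ {n} → PR n
  succᶠ : PR 1
  projᶠ : ∀ {n} → Fin n → PR n
  compᶠ : ∀ {m n} → PR m → Vec (PR n) m → PR n
  recᶠ  : ∀ {n} → PR n → PR (2 + n) → PR (1 + n)
  minᶠ  : ∀ {n} → PR (1 + n) → PR n

mutual
  data _[_]⇓_ : ∀ {n} → PR n → Vec ℕ n → ℕ → Set where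
    ⇓zero : ∀ {n} {xs : Vec ℕ n} → zeroᶠ [ xs ]⇓ 0
    ⇓succ : ∀ {x} → succᶠ [ x ∷ᵥ []ᵥ ]⇓ suc x
    ⇓proj : ∀ {n} {i : Fin n} {xs} → projᶠ i [ xs ]⇓ lookup xs i
    ⇓comp : ∀ {m n} {f : PR m} {gs : Vec (PR n) m} {xs ys y} →
            gs [ xs ]⇓* ys → f [ ys ]⇓ y → compᶠ f gs [ xs ]⇓ y
    ⇓rec0 : ∀ {n} {f : PR n} {g} {xs y} →
            f [ xs ]⇓ y → recᶠ f g [ 0 ∷ᵥ xs ]⇓ y
    ⇓recS : ∀ {n} {f : PR n} {g} {x xs y z} →
            recᶠ f g [ x ∷ᵥ xs ]⇓ y → g [ x ∷ᵥ y ∷ᵥ xs ]⇓ z →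
            recᶠ f g [ suc x ∷ᵥ xs ]⇓ z
    ⇓min  : ∀ {n} {f : PR (1 + n)} {xs y} →
            f [ y ∷ᵥ xs ]⇓ 0 →
            (∀ z → suc z ≤ y → Σ ℕ λ k → f [ z ∷ᵥ xs ]⇓ suc k) →
            minᶠ f [ xs ]⇓ y

  data _[_]⇓*_ : ∀ {m n} → Vec (PR n) m → Vec ℕ n → Vec ℕ m → Set where
    ⇓[] : ∀ {n} {xs : Vec ℕ n} → []ᵥ [ xs ]⇓* []ᵥ
    ⇓∷  : ∀ {m n} {g : PR n} {gs : Vec (PR n) m} {xs y ys} →
          g [ xs ]⇓ y → gs [ xs ]⇓* ys → (g ∷ᵥ gs) [ xs ]⇓* (y ∷ᵥ ys)

DecidesFragment : (κ : ℕ) → PR 1 → Set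
DecidesFragment κ e = ∀ (P : Problem κ) → InFragment κ P →
  (Valid κ P → e [ encProblem κ P ∷ᵥ []ᵥ ]⇓ 1)
  × (¬ Valid κ P → e [ encProblem κ P ∷ᵥ []ᵥ ]⇓ 0)

{-# OPTIONS --safe #-}
-- A word is a sequence of blocks of letters; each letter is read, written, both or
-- neither, so a block carries the configuration of a queue machine before a pass over
-- its queue (the symbols read) and after it (the symbols written). A word records a run
-- of the machine iff it follows the transitions and each block reads what the previous
-- one has written. The left-hand side describes the list heaps whose word follows the
-- transitions, with one predicate per machine state. The right-hand side describes the
-- lists containing two consecutive blocks that do not match: it guesses a pointer to
-- the second one and traverses both in lockstep, which non-connected rules can do,
-- and the traversal allocates the guessed pointer, so that they are established.
-- The entailment is thus valid iff the machine does not accept.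
--
-- A decision procedure e is refuted by diagonalisation. The rules depend only on the
-- machine, and the input n only occurs in the left-hand side, as a list of length n.
-- Hence the encoding of the problem for input n and rules with number t is an explicit
-- function of n and t; a machine that runs e on this encoding for t = n, started on the
-- number of its own rules, accepts iff e claims that it does not.
module Submission where

open import Defs
open import Data.Bool using (Bool; true; false)
open import Data.Empty using (⊥-elim)
open import Data.Fin using () renaming (zero to fzero; suc to fsuc)
open import Data.List
  using (List; []; _∷_; _++_; length; map; replicate; take; concatMap; upTo)
open import Data.List.Membership.Propositional using (_∈_; lose)
open import Data.List.Membership.Propositional.Properties
  using (∈-map⁺; ∈-map⁻; ∈-++⁺ˡ; ∈-++⁺ʳ; ∈-++⁻; ∈-concatMap⁺)
open import Data.List.Properties
  using (∷-injectiveˡ; ∷-injectiveʳ; ++-assoc; ++-identityʳ; length-upTo; take-map)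
open import Data.List.Relation.Binary.Pointwise using (Pointwise; []; _∷_)
open import Data.List.Relation.Unary.All as All using (All; []; _∷_; all?)
import Data.List.Relation.Unary.All.Properties as All
open import Data.List.Relation.Unary.Any using (here; there)
open import Data.List.Relation.Unary.Unique.Propositional.Properties using (upTo⁺)
open import Data.Maybe using (Maybe; just; nothing; is-just; _<∣>_)
open import Data.Maybe.Properties using (just-injective; <∣>-identityʳ)
open import Data.Nat
  using (ℕ; zero; suc; _+_; _*_; _^_; _≤_; _<_; z≤n; s≤s; _⊔_; _≟_)
open import Data.Nat.Properties
  using (+-suc; +-identityʳ; ≤-trans; <-trans; <-irrefl; <⇒≢; n<1+n; m≤m+n; m≤m⊔n; m≤n⊔m)
open import Data.List.Membership.DecPropositional _≟_ using (_∈?_)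
open import Data.Product using (Σ; _×_; _,_; proj₁; proj₂)
open import Data.Sum using (_⊎_; inj₁; inj₂; [_,_])
open import Data.Unit using (⊤; tt)
open import Data.Vec using (Vec; lookup; toList)
  renaming ([] to []ᵥ; _∷_ to _∷ᵥ_; map to mapᵥ)
open import Relation.Binary.Construct.Closure.ReflexiveTransitive using (Star; ε; _◅_; _◅◅_)
open import Relation.Binary.PropositionalEquality
  using (_≡_; _≢_; refl; sym; trans; cong; cong₂; subst; subst₂)
open import Relation.Nullary using (¬_; Dec; yes; no; _×-dec_; _⊎-dec_)
open import Relation.Nullary.Decidable using (from-yes)

-- Letters, words and mismatching blocks

data Sym : Set where
  one sep : Sym

_≟ˢ_ : (s s' : Sym) → Dec (s ≡ s')
one ≟ˢ one = yes refl
one ≟ˢ sep = no λ ()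
sep ≟ˢ one = no λ ()
sep ≟ˢ sep = yes refl

data Letter : Set where
  nop         : Letter
  cp put del  : Sym → Letter

data Token : Set where
  end : Token
  ⟨_⟩ : Letter → Token

Word : Set
Word = List Token

rd wr : Letter → Maybe Sym
rd nop     = nothing
rd (cp s)  = just s
rd (put s) = nothing
rd (del s) = just s
wr nop     = nothing
wr (cp s)  = just s
wr (put s) = just s
wr (del s) = nothing

infixr 5 _?∷_
_?∷_ : Maybe Sym → List Sym → List Sym
nothing ?∷ o = o
just s  ?∷ o = s ∷ o

written : Word → List Sym
written []          = []
written (end ∷ w)   = []
written (⟨ l ⟩ ∷ w) = wr l ?∷ written w

after : Word → Word
after []          = []
after (end ∷ w)   = w
after (⟨ _ ⟩ ∷ w) = after w

-- The list holds what the previous block wrote and the current one has yet to read. There is no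
-- constructor for the empty word: the last block may be cut short, since the machine may halt with
-- symbols still unread.
data Mismatch : List Sym → Word → Set where
  skip  : ∀ {o l w} → rd l ≡ nothing → Mismatch o w → Mismatch o (⟨ l ⟩ ∷ w)
  same  : ∀ {s o l w} → rd l ≡ just s → Mismatch o w → Mismatch (s ∷ o) (⟨ l ⟩ ∷ w)
  diff  : ∀ {s s' o l w} → rd l ≡ just s' → s ≢ s' → Mismatch (s ∷ o) (⟨ l ⟩ ∷ w)
  long  : ∀ {s l w} → rd l ≡ just s → Mismatch [] (⟨ l ⟩ ∷ w)
  short : ∀ {s o w} → Mismatch (s ∷ o) (end ∷ w)

data Faulty : Word → Set where
  later : ∀ {t w} → Faulty w → Faulty (t ∷ w)
  now   : ∀ {w} → Mismatch (written w) (after w) → Faulty (end ∷ w)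

-- The two lists are the symbols the current block still has to read, and those it has
-- written so far; at the end of a block the latter become the former.
data Fire : Token → List Sym → List Sym → List Sym → List Sym → Set where
  close : ∀ {o} → Fire end [] o o []
  move  : ∀ {i o} l → Fire ⟨ l ⟩ (rd l ?∷ i) o i (o ++ (wr l ?∷ []))

data Good : List Sym → List Sym → Word → Set where
  stop   : ∀ {i o} → Good i o []
  _then_ : ∀ {t i o i' o' w} → Fire t i o i' o' → Good i' o' w → Good i o (t ∷ w)

snoc-?∷ : ∀ o m r → (o ++ (m ?∷ [])) ++ r ≡ o ++ (m ?∷ r)
snoc-?∷ o nothing  r = cong (_++ r) (++-identityʳ o)
snoc-?∷ o (just s) r = ++-assoc o (s ∷ []) r

-- The equation is a separate hypothesis because the index `rd l ?∷ i` of `move` does not unify with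
-- the list patterns of `Mismatch`.
good⇒¬mismatch : ∀ {i i' o w} → Good i o w → i ≡ i' → ¬ Mismatch i' w
good⇒¬mismatch stop _ ()
good⇒¬mismatch (close then g) () short
good⇒¬mismatch (move l then g) p (skip eq m) rewrite eq = good⇒¬mismatch g p m
good⇒¬mismatch (move l then g) p (same eq m) rewrite eq = good⇒¬mismatch g (∷-injectiveʳ p) m
good⇒¬mismatch (move l then g) p (diff eq s≢s') rewrite eq = s≢s' (sym (∷-injectiveˡ p))
good⇒¬mismatch (move l then g) p (long eq) rewrite eq with () ← p

-- The output `o` so far, completed by what the block still writes, becomes the input of the next
-- block at the closing `end`; there `good⇒¬mismatch` applies.
good⇒¬next : ∀ {i o w} → Good i o w → ¬ Mismatch (o ++ written w) (after w)
good⇒¬next stop ()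
good⇒¬next {o = o} (close then g) m =
  good⇒¬mismatch g refl (subst (λ x → Mismatch x _) (++-identityʳ o) m)
good⇒¬next {o = o} (_then_ {w = w} (move l) g) m =
  good⇒¬next g (subst (λ x → Mismatch x (after w)) (sym (snoc-?∷ o (wr l) (written w))) m)

good⇒¬faulty : ∀ {i o w} → Good i o w → ¬ Faulty w
good⇒¬faulty (close then g) (later f) = good⇒¬faulty g f
good⇒¬faulty (close then g) (now m)   = good⇒¬next g m
good⇒¬faulty (move l then g) (later f)  = good⇒¬faulty g f

-- The failures are sorted by the first block of the bad pair: the previous one, whose unread output
-- is `i`; the current one, which has written `o`; or one that starts after an `end` of `w`.
-- Crossing an `end` moves each case one place on, and the last stays.
good-or-faulty : ∀ i o w →
  Good i o w ⊎ Mismatch i w ⊎ Mismatch (o ++ written w) (after w) ⊎ Faulty w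
good-or-faulty i o [] = inj₁ stop
good-or-faulty (s ∷ i) o (end ∷ w) = inj₂ (inj₁ short)
good-or-faulty [] o (end ∷ w) with good-or-faulty o [] w
... | inj₁ g = inj₁ (close then g)
... | inj₂ (inj₁ m) = inj₂ (inj₂ (inj₁ (subst (λ x → Mismatch x w) (sym (++-identityʳ o)) m)))
... | inj₂ (inj₂ (inj₁ m)) = inj₂ (inj₂ (inj₂ (now m)))
... | inj₂ (inj₂ (inj₂ f)) = inj₂ (inj₂ (inj₂ (later f)))
good-or-faulty i o (⟨ l ⟩ ∷ w) = go (rd l) refl i
  where
  read-off : ∀ i → Good (rd l ?∷ i) o (⟨ l ⟩ ∷ w) ⊎ Mismatch i w
                   ⊎ Mismatch (o ++ written (⟨ l ⟩ ∷ w)) (after w) ⊎ Faulty (⟨ l ⟩ ∷ w)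
  read-off i with good-or-faulty i (o ++ (wr l ?∷ [])) w
  ... | inj₁ g = inj₁ (move l then g)
  ... | inj₂ (inj₁ m) = inj₂ (inj₁ m)
  ... | inj₂ (inj₂ (inj₁ m)) =
    inj₂ (inj₂ (inj₁ (subst (λ x → Mismatch x (after w)) (snoc-?∷ o (wr l) (written w)) m)))
  ... | inj₂ (inj₂ (inj₂ f)) = inj₂ (inj₂ (inj₂ (later f)))

  go : ∀ m → rd l ≡ m → ∀ i → Good i o (⟨ l ⟩ ∷ w) ⊎ Mismatch i (⟨ l ⟩ ∷ w)
                   ⊎ Mismatch (o ++ written (⟨ l ⟩ ∷ w)) (after w) ⊎ Faulty (⟨ l ⟩ ∷ w)
  go nothing eq i with read-off i
  ... | inj₁ g = inj₁ (subst (λ m → Good (m ?∷ i) o (⟨ l ⟩ ∷ w)) eq g)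
  ... | inj₂ (inj₁ m) = inj₂ (inj₁ (skip eq m))
  ... | inj₂ (inj₂ r) = inj₂ (inj₂ r)
  go (just s) eq [] = inj₂ (inj₁ (long eq))
  go (just s) eq (s' ∷ i) with s' ≟ˢ s
  ... | no s'≢s = inj₂ (inj₁ (diff eq s'≢s))
  ... | yes refl with read-off i
  ...   | inj₁ g = inj₁ (subst (λ m → Good (m ?∷ i) o (⟨ l ⟩ ∷ w)) eq g)
  ...   | inj₂ (inj₁ m) = inj₂ (inj₁ (same eq m))
  ...   | inj₂ (inj₂ r) = inj₂ (inj₂ r)

-- Queue machines

-- `decOr j` deletes a unit and goes on, or jumps to j if the block is 0.
data Instr : Set where
  copyBlock copyRest delBlock halt : Instr
  put      : Sym → Instr
  decOr goto : ℕ → Instr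

Code : Set
Code = List Instr

choices : ℕ → Instr → List (Token × ℕ)
choices q copyBlock = (⟨ cp one ⟩ , q) ∷ (⟨ cp sep ⟩ , suc q) ∷ []
choices q copyRest  = (⟨ cp one ⟩ , q) ∷ (⟨ cp sep ⟩ , q) ∷ (end , suc q) ∷ []
choices q delBlock  = (⟨ del one ⟩ , q) ∷ (⟨ del sep ⟩ , suc q) ∷ []
choices q halt      = []
choices q (put s)   = (⟨ put s ⟩ , suc q) ∷ []
choices q (decOr j) = (⟨ del one ⟩ , suc q) ∷ (⟨ cp sep ⟩ , j) ∷ []
choices q (goto j)  = (⟨ nop ⟩ , j) ∷ []

data At : Code → ℕ → Instr → Set where
  atZ : ∀ {x c} → At (x ∷ c) 0 x
  atS : ∀ {x y c q} → At c q x → At (y ∷ c) (suc q) x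

At-functional : ∀ {c q x y} → At c q x → At c q y → x ≡ y
At-functional atZ atZ = refl
At-functional (atS a) (atS b) = At-functional a b

At-++ˡ : ∀ {c c' q x} → At c q x → At (c ++ c') q x
At-++ˡ atZ = atZ
At-++ˡ (atS a) = atS (At-++ˡ a)

At-++ʳ : ∀ c {c' q x} → At c' q x → At (c ++ c') (length c + q) x
At-++ʳ [] a = a
At-++ʳ (_ ∷ c) a = atS (At-++ʳ c a)

At-length : ∀ {c q x} → At c q x → q < length c
At-length atZ = s≤s z≤n
At-length (atS a) = s≤s (At-length a)

data Path (c : Code) : ℕ → Word → Set where
  stop : ∀ {q} → At c q halt → Path c q []
  along : ∀ {q x t q' w} → At c q x → (t , q') ∈ choices q x → Path c q' w → Path c q (t ∷ w)

Config : Set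
Config = ℕ × List Sym × List Sym

data Step (c : Code) : Config → Config → Set where
  fire : ∀ {q x t q' i o i' o'} → At c q x → (t , q') ∈ choices q x → Fire t i o i' o' →
         Step c (q , i , o) (q' , i' , o')

Steps : Code → Config → Config → Set
Steps c = Star (Step c)

run⇒word : ∀ {c q i o q' i' o'} → Steps c (q , i , o) (q' , i' , o') → At c q' halt →
           Σ Word λ w → Path c q w × Good i o w
run⇒word ε h = [] , stop h , stop
run⇒word (fire {t = t} a m f ◅ r) h with run⇒word r h
... | w , p , g = t ∷ w , along a m p , f then g

-- What a token reveals about the unread input: `just nothing` that it is empty, `just (just s)`
-- that it begins with `s`, `nothing` if the token reads no symbol and does not close the block.
visible : Token → Maybe (Maybe Sym)
visible end   = just nothing
visible ⟨ l ⟩ with rd l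
... | nothing = nothing
... | just s  = just (just s)

Clash : Token → Token → Set
Clash t t' = Σ (Maybe Sym) λ v → Σ (Maybe Sym) λ v' →
  visible t ≡ just v × visible t' ≡ just v' × v ≢ v'

-- The alternatives of an instruction demand different fronts of the input, so the queue resolves
-- every choice and the machine is deterministic.
choices-functional : ∀ q x {t t' q₁ q₂} → (t , q₁) ∈ choices q x → (t' , q₂) ∈ choices q x →
  (t ≡ t' × q₁ ≡ q₂) ⊎ Clash t t'
choices-functional q copyBlock (here refl) (here refl) = inj₁ (refl , refl)
choices-functional q copyBlock (there (here refl)) (there (here refl)) = inj₁ (refl , refl)
choices-functional q copyBlock (here refl) (there (here refl)) = inj₂ (_ , _ , refl , refl , λ ())
choices-functional q copyBlock (there (here refl)) (here refl) = inj₂ (_ , _ , refl , refl , λ ())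
choices-functional q copyRest (here refl) (here refl) = inj₁ (refl , refl)
choices-functional q copyRest (there (here refl)) (there (here refl)) = inj₁ (refl , refl)
choices-functional q copyRest (there (there (here refl))) (there (there (here refl))) = inj₁ (refl , refl)
choices-functional q copyRest (here refl) (there (here refl)) = inj₂ (_ , _ , refl , refl , λ ())
choices-functional q copyRest (here refl) (there (there (here refl))) = inj₂ (_ , _ , refl , refl , λ ())
choices-functional q copyRest (there (here refl)) (here refl) = inj₂ (_ , _ , refl , refl , λ ())
choices-functional q copyRest (there (here refl)) (there (there (here refl))) = inj₂ (_ , _ , refl , refl , λ ())
choices-functional q copyRest (there (there (here refl))) (here refl) = inj₂ (_ , _ , refl , refl , λ ())
choices-functional q copyRest (there (there (here refl))) (there (here refl)) = inj₂ (_ , _ , refl , refl , λ ())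
choices-functional q delBlock (here refl) (here refl) = inj₁ (refl , refl)
choices-functional q delBlock (there (here refl)) (there (here refl)) = inj₁ (refl , refl)
choices-functional q delBlock (here refl) (there (here refl)) = inj₂ (_ , _ , refl , refl , λ ())
choices-functional q delBlock (there (here refl)) (here refl) = inj₂ (_ , _ , refl , refl , λ ())
choices-functional q (put s) (here refl) (here refl) = inj₁ (refl , refl)
choices-functional q (decOr j) (here refl) (here refl) = inj₁ (refl , refl)
choices-functional q (decOr j) (there (here refl)) (there (here refl)) = inj₁ (refl , refl)
choices-functional q (decOr j) (here refl) (there (here refl)) = inj₂ (_ , _ , refl , refl , λ ())
choices-functional q (decOr j) (there (here refl)) (here refl) = inj₂ (_ , _ , refl , refl , λ ())
choices-functional q (goto j) (here refl) (here refl) = inj₁ (refl , refl)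

front : List Sym → Maybe Sym
front []      = nothing
front (s ∷ _) = just s

fire-front : ∀ {t i o i' o' v} → Fire t i o i' o' → visible t ≡ just v → v ≡ front i
fire-front close refl = refl
fire-front (move l) eq with rd l | eq
... | just s | refl = refl

?∷-injective : ∀ m {i i'} → (m ?∷ i) ≡ (m ?∷ i') → i ≡ i'
?∷-injective nothing  p = p
?∷-injective (just _) p = ∷-injectiveʳ p

fire-functional : ∀ {t i j o i' o' j' p'} → i ≡ j → Fire t i o i' o' → Fire t j o j' p' →
                  i' ≡ j' × o' ≡ p'
fire-functional _ close close = refl , refl
fire-functional e (move l) (move _) = ?∷-injective (rd l) e , refl

-- By determinism a good word on a path must retrace the run, and so reaches the position without
-- instruction, where a path can neither stop nor continue.
stuck⇒¬word : ∀ {c q i o q' i' o' w} → Steps c (q , i , o) (q' , i' , o') → (∀ x → ¬ At c q' x) →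
              Path c q w → ¬ Good i o w
stuck⇒¬word ε dead (stop a) _ = dead _ a
stuck⇒¬word ε dead (along a _ _) _ = dead _ a
stuck⇒¬word (fire a m _ ◅ _) dead (stop h) _ with refl ← At-functional a h with () ← m
stuck⇒¬word (fire {q} {x} a m f ◅ r) dead (along a' m' p) (f' then g)
  with refl ← At-functional a a' with choices-functional q x m m'
... | inj₂ (v , v' , e , e' , v≢v') = v≢v' (trans (fire-front f e) (sym (fire-front f' e')))
... | inj₁ (refl , refl) with refl , refl ← fire-functional refl f f' = stuck⇒¬word r dead p g

-- Stack programs

data Prog : Set where
  skip push0 : Prog
  inc del    : ℕ → Prog
  while      : ℕ → Prog → Prog
  _⨾_        : Prog → Prog → Prog

infixr 5 _⨾_
infix 4 _⊢_⇒_

data _⊢_⇒_ : Prog → List ℕ → List ℕ → Set where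
  skip  : ∀ {st} → skip ⊢ st ⇒ st
  push0 : ∀ {st} → push0 ⊢ st ⇒ 0 ∷ st
  inc   : ∀ xs {n ys} → inc (length xs) ⊢ xs ++ n ∷ ys ⇒ xs ++ suc n ∷ ys
  del   : ∀ xs {n ys} → del (length xs) ⊢ xs ++ n ∷ ys ⇒ xs ++ ys
  exit  : ∀ xs {c ys} → while (length xs) c ⊢ xs ++ 0 ∷ ys ⇒ xs ++ 0 ∷ ys
  loop  : ∀ xs {c n ys st st'} → c ⊢ xs ++ n ∷ ys ⇒ st → while (length xs) c ⊢ st ⇒ st' →
          while (length xs) c ⊢ xs ++ suc n ∷ ys ⇒ st'
  _⨾_   : ∀ {c d st st' st''} → c ⊢ st ⇒ st' → d ⊢ st' ⇒ st'' → c ⨾ d ⊢ st ⇒ st''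

-- Translation of stack programs into queue code

exitPos : ℕ → Prog → ℕ
exitPos i skip        = i
exitPos i push0       = 2 + i
exitPos i (inc k)     = 2 + (k + i)
exitPos i (del k)     = 2 + (k + i)
exitPos i (while k c) = 2 + exitPos (2 + (k + i)) c
exitPos i (c ⨾ d)     = exitPos (exitPos i c) d

-- Each primitive operation and each loop test is one pass over the queue: the `k` blocks above the
-- entry are copied, the entry is acted on, and the rest is copied, so the order of the stack is
-- restored.
assemble : ℕ → Prog → Code
assemble i skip        = []
assemble i push0       = put sep ∷ copyRest ∷ []
assemble i (inc k)     = replicate k copyBlock ++ put one ∷ copyRest ∷ []
assemble i (del k)     = replicate k copyBlock ++ delBlock ∷ copyRest ∷ []
assemble i (while k c) =
  -- A failed test jumps to the last `copyRest`, so that the pass begun at `i` is completed before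
  -- the loop is left; the `goto` keeps the body from running into it.
  replicate k copyBlock ++ decOr (suc (exitPos (2 + (k + i)) c)) ∷ copyRest ∷
  assemble (2 + (k + i)) c ++ goto i ∷ copyRest ∷ []
assemble i (c ⨾ d)     = assemble i c ++ assemble (exitPos i c) d

advance : ℕ → Code → ℕ
advance i []      = i
advance i (_ ∷ f) = advance (suc i) f

advance-++ : ∀ i f g → advance i (f ++ g) ≡ advance (advance i f) g
advance-++ i []      g = refl
advance-++ i (_ ∷ f) g = advance-++ (suc i) f g

advance-replicate : ∀ i k x → advance i (replicate k x) ≡ k + i
advance-replicate i zero    x = refl
advance-replicate i (suc k) x = trans (advance-replicate (suc i) k x) (+-suc k i)

advance-length : ∀ i f → advance i f ≡ length f + i
advance-length i []      = refl
advance-length i (_ ∷ f) = trans (advance-length (suc i) f) (+-suc (length f) i)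

advance-replicate-++ : ∀ i k x g → advance i (replicate k x ++ g) ≡ advance (k + i) g
advance-replicate-++ i k x g =
  trans (advance-++ i (replicate k x) g) (cong (λ j → advance j g) (advance-replicate i k x))

-- The exit jump of a loop is needed before its body is laid out, so `exitPos` is computed from the
-- program alone; here it is tied to the code actually produced.
advance-assemble : ∀ i c → advance i (assemble i c) ≡ exitPos i c
advance-assemble i skip = refl
advance-assemble i push0 = refl
advance-assemble i (inc k) = advance-replicate-++ i k _ _
advance-assemble i (del k) = advance-replicate-++ i k _ _
advance-assemble i (while k c) =
  trans (advance-replicate-++ i k _ _)
  (trans (advance-++ (2 + (k + i)) (assemble (2 + (k + i)) c) _)
         (cong (2 +_) (advance-assemble (2 + (k + i)) c)))
advance-assemble i (c ⨾ d) =
  trans (advance-++ i (assemble i c) _)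
  (trans (cong (λ j → advance j (assemble (exitPos i c) d)) (advance-assemble i c))
         (advance-assemble (exitPos i c) d))

Loaded : Code → ℕ → Code → Set
Loaded K i []      = ⊤
Loaded K i (x ∷ f) = At K i x × Loaded K (suc i) f

Loaded-weaken : ∀ {K i y} f → Loaded K i f → Loaded (y ∷ K) (suc i) f
Loaded-weaken []      _       = tt
Loaded-weaken (_ ∷ f) (a , l) = atS a , Loaded-weaken f l

Loaded-refl : ∀ f → Loaded f 0 f
Loaded-refl []      = tt
Loaded-refl (_ ∷ f) = atZ , Loaded-weaken f (Loaded-refl f)

Loaded-++ : ∀ {K} i f {g} → Loaded K i (f ++ g) → Loaded K i f × Loaded K (advance i f) g
Loaded-++ i []      l = tt , l
Loaded-++ i (_ ∷ f) (a , l) with Loaded-++ (suc i) f l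
... | l₁ , l₂ = (a , l₁) , l₂

Loaded-replicate : ∀ {K} i k {x g} → Loaded K i (replicate k x ++ g) →
                   Loaded K i (replicate k x) × Loaded K (k + i) g
Loaded-replicate {K} i k {x} {g} l with Loaded-++ i (replicate k x) l
... | l₁ , l₂ = l₁ , subst (λ j → Loaded K j g) (advance-replicate i k x) l₂

Loaded-assemble : ∀ {K} i c {g} → Loaded K i (assemble i c ++ g) →
                  Loaded K i (assemble i c) × Loaded K (exitPos i c) g
Loaded-assemble {K} i c {g} l with Loaded-++ i (assemble i c) l
... | l₁ , l₂ = l₁ , subst (λ j → Loaded K j g) (advance-assemble i c) l₂

block : ℕ → List Sym → List Sym
block zero    r = sep ∷ r
block (suc n) r = one ∷ block n r

blocks : List ℕ → List Sym → List Sym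
blocks []       r = r
blocks (n ∷ st) r = block n (blocks st r)

block-++ : ∀ n r → block n [] ++ r ≡ block n r
block-++ zero    r = refl
block-++ (suc n) r = cong (one ∷_) (block-++ n r)

blocks-++ : ∀ st r → blocks st [] ++ r ≡ blocks st r
blocks-++ []       r = refl
blocks-++ (n ∷ st) r = trans (cong (_++ r) (sym (block-++ n (blocks st []))))
  (trans (++-assoc (block n []) (blocks st []) r)
  (trans (cong (block n [] ++_) (blocks-++ st r)) (block-++ n (blocks st r))))

blocks-append : ∀ xs ys r → blocks (xs ++ ys) r ≡ blocks xs (blocks ys r)
blocks-append []       ys r = refl
blocks-append (x ∷ xs) ys r = cong (block x) (blocks-append xs ys r)

module _ {K : Code} where

  to-output : ∀ {c q i o o'} → Steps K c (q , i , o) → o ≡ o' → Steps K c (q , i , o')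
  to-output r refl = r

  from-input : ∀ {c q i i' o} → i ≡ i' → Steps K (q , i , o) c → Steps K (q , i' , o) c
  from-input refl r = r

  copyBlock-steps : ∀ {q} → At K q copyBlock → ∀ n r o →
                    Steps K (q , block n r , o) (suc q , r , o ++ block n [])
  copyBlock-steps a zero    r o = fire a (there (here refl)) (move (cp sep)) ◅ ε
  copyBlock-steps a (suc n) r o = fire a (here refl) (move (cp one)) ◅
    to-output (copyBlock-steps a n r _) (++-assoc o (one ∷ []) (block n []))

  delBlock-steps : ∀ {q} → At K q delBlock → ∀ n r o →
                   Steps K (q , block n r , o) (suc q , r , o)
  delBlock-steps a zero    r o =
    to-output (fire a (there (here refl)) (move (del sep)) ◅ ε) (++-identityʳ o)
  delBlock-steps a (suc n) r o = fire a (here refl) (move (del one)) ◅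
    subst (λ o' → Steps K (_ , block n r , o') (_ , r , o)) (sym (++-identityʳ o))
      (delBlock-steps a n r o)

  copyRest-steps : ∀ {q} → At K q copyRest → ∀ i o →
                   Steps K (q , i , o) (suc q , o ++ i , [])
  copyRest-steps a [] o = subst (λ o' → Steps K (_ , [] , o) (_ , o' , [])) (sym (++-identityʳ o))
    (fire a (there (there (here refl))) close ◅ ε)
  copyRest-steps a (s ∷ i) o = copied s ◅
    subst (λ o' → Steps K (_ , i , o ++ (s ∷ [])) (_ , o' , [])) (++-assoc o (s ∷ []) i)
      (copyRest-steps a i (o ++ (s ∷ [])))
    where
    copied : ∀ s → Step K (_ , s ∷ i , o) (_ , i , o ++ (s ∷ []))
    copied one = fire a (here refl) (move (cp one))
    copied sep = fire a (there (here refl)) (move (cp sep))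

  copyBlocks-steps : ∀ {q} xs r o → Loaded K q (replicate (length xs) copyBlock) →
                     Steps K (q , blocks xs r , o) (length xs + q , r , o ++ blocks xs [])
  copyBlocks-steps []       r o l = to-output ε (sym (++-identityʳ o))
  copyBlocks-steps {q} (n ∷ xs) r o (a , l) = copyBlock-steps a n (blocks xs r) o ◅◅
    subst (λ j → Steps K (suc q , blocks xs r , o ++ block n []) (j , r , o ++ blocks (n ∷ xs) []))
      (+-suc (length xs) q)
      (to-output (copyBlocks-steps xs r (o ++ block n []) l)
        (trans (++-assoc o (block n []) (blocks xs []))
               (cong (o ++_) (block-++ n (blocks xs [])))))

  at-block : ∀ {q q'} xs ys {o r} → Loaded K q (replicate (length xs) copyBlock) →
    Steps K (length xs + q , blocks ys [] , blocks xs []) (q' , r , o) →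
    Steps K (q , blocks (xs ++ ys) [] , []) (q' , r , o)
  at-block xs ys l rest =
    from-input (sym (blocks-append xs ys [])) (copyBlocks-steps xs (blocks ys []) [] l ◅◅ rest)

  copyRest-blocks : ∀ {q} → At K q copyRest → ∀ m st {o} → o ++ blocks m [] ≡ blocks st [] →
    Steps K (q , blocks m [] , o) (suc q , blocks st [] , [])
  copyRest-blocks a m st {o} eq =
    subst (λ i → Steps K (_ , blocks m [] , o) (_ , i , [])) eq (copyRest-steps a (blocks m []) o)

  join : ∀ xs m → blocks xs [] ++ blocks m [] ≡ blocks (xs ++ m) []
  join xs m = trans (blocks-++ xs _) (sym (blocks-append xs m []))

  assemble-correct : ∀ i c {st st'} → Loaded K i (assemble i c) → c ⊢ st ⇒ st' →
    Steps K (i , blocks st [] , []) (exitPos i c , blocks st' [] , [])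
  assemble-correct i skip l skip = ε
  assemble-correct i push0 (a , b , _) push0 =
    fire a (here refl) (move (put sep)) ◅ copyRest-steps b _ _
  assemble-correct i (inc _) l (inc xs {n} {ys}) with Loaded-replicate i (length xs) l
  ... | l₁ , a , b , _ = at-block xs (n ∷ ys) l₁ (fire a (here refl) (move (put one)) ◅
    copyRest-blocks b (n ∷ ys) (xs ++ suc n ∷ ys)
      (trans (++-assoc (blocks xs []) (one ∷ []) _) (join xs (suc n ∷ ys))))
  assemble-correct i (del _) l (del xs {n} {ys}) with Loaded-replicate i (length xs) l
  ... | l₁ , a , b , _ = at-block xs (n ∷ ys) l₁ (delBlock-steps a n (blocks ys []) _ ◅◅
    copyRest-blocks b ys (xs ++ ys) (join xs ys))
  assemble-correct i (while _ c) l (exit xs {ys = ys}) with Loaded-replicate i (length xs) l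
  ... | l₁ , a , _ , l₂ with Loaded-assemble (2 + (length xs + i)) c l₂
  ...   | _ , _ , b , _ = at-block xs (0 ∷ ys) l₁ (fire a (there (here refl)) (move (cp sep)) ◅
    copyRest-blocks b ys (xs ++ 0 ∷ ys) (trans (++-assoc (blocks xs []) (sep ∷ []) _) (join xs (0 ∷ ys))))
  assemble-correct i (while k c) l (loop xs {n = n} {ys = ys} d e)
    with Loaded-replicate i (length xs) l
  ... | l₁ , a , r , l₂ with Loaded-assemble (2 + (length xs + i)) c l₂
  ...   | l₃ , g , _ = at-block xs (suc n ∷ ys) l₁ (fire a (here refl) (move (del one)) ◅
    (copyRest-blocks r (n ∷ ys) (xs ++ n ∷ ys)
      (trans (cong (_++ blocks (n ∷ ys) []) (++-identityʳ (blocks xs []))) (join xs (n ∷ ys))) ◅◅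
    (assemble-correct _ c l₃ d ◅◅
    -- The letter `nop` reads and writes nothing, so the jump back to `i` starts a fresh pass on the
    -- queue as the body left it.
    (fire g (here refl) (move nop) ◅ assemble-correct i (while k c) l e))))
  assemble-correct i (c ⨾ c') l (d ⨾ e) with Loaded-assemble i c l
  ... | l₁ , l₂ = assemble-correct i c l₁ d ◅◅ assemble-correct _ c' l₂ e

-- From μ-recursive functions to stack programs

data Nth : List ℕ → ℕ → ℕ → Set where
  nthZ : ∀ {n st} → Nth (n ∷ st) 0 n
  nthS : ∀ {n m st k} → Nth st k n → Nth (m ∷ st) (suc k) n

data Args (st : List ℕ) : ∀ {m} → Vec ℕ m → Vec ℕ m → Set where
  []  : Args st []ᵥ []ᵥ
  _∷_ : ∀ {m k n} {a xs : Vec ℕ m} → Nth st k n → Args st a xs → Args st (k ∷ᵥ a) (n ∷ᵥ xs)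

Args-lookup : ∀ {st m} {a xs : Vec ℕ m} → Args st a xs → ∀ i → Nth st (lookup a i) (lookup xs i)
Args-lookup (p ∷ ps) fzero    = p
Args-lookup (p ∷ ps) (fsuc i) = Args-lookup ps i

Args-map : ∀ {st st'} {f : ℕ → ℕ} → (∀ {k n} → Nth st k n → Nth st' (f k) n) →
           ∀ {m} {a xs : Vec ℕ m} → Args st a xs → Args st' (mapᵥ f a) xs
Args-map φ []       = []
Args-map φ (p ∷ ps) = φ p ∷ Args-map φ ps

Nth-++ : ∀ {m} (ys : Vec ℕ m) {st k n} → Nth st k n → Nth (toList ys ++ st) (m + k) n
Nth-++ []ᵥ       p = p
Nth-++ (_ ∷ᵥ ys) p = nthS (Nth-++ ys p)

iota : ∀ m → Vec ℕ m
iota zero    = []ᵥ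
iota (suc m) = 0 ∷ᵥ mapᵥ suc (iota m)

Args-iota : ∀ {m} (ys : Vec ℕ m) st → Args (toList ys ++ st) (iota m) ys
Args-iota []ᵥ       st = []
Args-iota (y ∷ᵥ ys) st = nthZ ∷ Args-map nthS (Args-iota ys st)

-- A loop test consumes the entry it tests. Hence the entry is first moved into two new ones and
-- then restored from one of them.
dup : ℕ → Prog
dup k = push0 ⨾ push0 ⨾ while (2 + k) (inc 0 ⨾ inc 1) ⨾ while 0 (inc (2 + k)) ⨾ del 0

dup-correct : ∀ {st k n} → Nth st k n → dup k ⊢ st ⇒ n ∷ st
dup-correct {st} {k} {n} p with split p
  where
  split : ∀ {st k n} → Nth st k n → Σ (List ℕ) λ xs → Σ (List ℕ) λ ys →
          st ≡ xs ++ n ∷ ys × k ≡ length xs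
  split (nthZ {st = st}) = [] , st , refl , refl
  split (nthS {m = m} p) with split p
  ... | xs , ys , refl , refl = m ∷ xs , ys , refl , refl
... | xs , ys , refl , refl = push0 ⨾ push0 ⨾ fan' ⨾ restore' ⨾ del []
  where
  fan : ∀ n a b → while (2 + length xs) (inc 0 ⨾ inc 1) ⊢
        a ∷ b ∷ xs ++ n ∷ ys ⇒ n + a ∷ n + b ∷ xs ++ 0 ∷ ys
  fan zero    a b = exit (a ∷ b ∷ xs)
  fan (suc n) a b = loop (a ∷ b ∷ xs) (inc [] ⨾ inc (suc a ∷ []))
    (subst₂ (λ u v → while (2 + length xs) (inc 0 ⨾ inc 1) ⊢
               suc a ∷ suc b ∷ xs ++ n ∷ ys ⇒ u ∷ v ∷ xs ++ 0 ∷ ys)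
      (+-suc n a) (+-suc n b) (fan n (suc a) (suc b)))

  fan' : while (2 + length xs) (inc 0 ⨾ inc 1) ⊢ 0 ∷ 0 ∷ xs ++ n ∷ ys ⇒ n ∷ n ∷ xs ++ 0 ∷ ys
  fan' = subst (λ u → while (2 + length xs) (inc 0 ⨾ inc 1) ⊢
                      0 ∷ 0 ∷ xs ++ n ∷ ys ⇒ u ∷ u ∷ xs ++ 0 ∷ ys) (+-identityʳ n) (fan n 0 0)

  restore : ∀ n b m → while 0 (inc (2 + length xs)) ⊢
            n ∷ b ∷ xs ++ m ∷ ys ⇒ 0 ∷ b ∷ xs ++ n + m ∷ ys
  restore zero    b m = exit []
  restore (suc n) b m = loop [] (inc (n ∷ b ∷ xs))
    (subst (λ u → while 0 (inc (2 + length xs)) ⊢ n ∷ b ∷ xs ++ suc m ∷ ys ⇒ 0 ∷ b ∷ xs ++ u ∷ ys)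
      (+-suc n m) (restore n b (suc m)))

  restore' : while 0 (inc (2 + length xs)) ⊢ n ∷ n ∷ xs ++ 0 ∷ ys ⇒ 0 ∷ n ∷ xs ++ n ∷ ys
  restore' = subst (λ u → while 0 (inc (2 + length xs)) ⊢
                          n ∷ n ∷ xs ++ 0 ∷ ys ⇒ 0 ∷ n ∷ xs ++ u ∷ ys) (+-identityʳ n) (restore n n 0)

delUnder : ℕ → Prog
delUnder zero    = skip
delUnder (suc m) = del 1 ⨾ delUnder m

delUnder-correct : ∀ {m} y (ys : Vec ℕ m) st → delUnder m ⊢ y ∷ toList ys ++ st ⇒ y ∷ st
delUnder-correct y []ᵥ       st = skip
delUnder-correct y (_ ∷ᵥ ys) st = del (y ∷ []) ⨾ delUnder-correct y ys st

-- The arguments are given by their depths in the stack; the result is pushed.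
mutual
  compile : ∀ {m} → PR m → Vec ℕ m → Prog
  compile zeroᶠ a = push0
  compile succᶠ (k ∷ᵥ []ᵥ) = dup k ⨾ inc 0
  compile (projᶠ i) a = dup (lookup a i)
  compile (compᶠ {m} f gs) a = compile* gs a ⨾ compile f (iota m) ⨾ delUnder m
  compile (recᶠ f g) (k ∷ᵥ a) =
    -- In the loop the stack consists of the current value, the number of iterations left and the
    -- index of the iteration, above the original stack; this explains the depths 2, 0 and the shift
    -- by 3.
    push0 ⨾ dup (suc k) ⨾ compile f (mapᵥ (2 +_) a) ⨾
    while 1 (compile g (2 ∷ᵥ 0 ∷ᵥ mapᵥ (3 +_) a) ⨾ del 1 ⨾ inc 2) ⨾ del 1 ⨾ del 1
  compile (minᶠ f) a =
    -- The candidate lies below the value of `f` at it. The loop tests this value, discards what the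
    -- test has left of it, and evaluates `f` at the next candidate.
    push0 ⨾ compile f (0 ∷ᵥ mapᵥ suc a) ⨾
    while 0 (del 0 ⨾ inc 0 ⨾ compile f (0 ∷ᵥ mapᵥ suc a)) ⨾ del 0

  -- The last function is run first, so that the first result ends up on top, as `iota` expects.
  compile* : ∀ {m n} → Vec (PR n) m → Vec ℕ n → Prog
  compile* []ᵥ a = skip
  compile* {suc m} (g ∷ᵥ gs) a = compile* gs a ⨾ compile g (mapᵥ (m +_) a)

mutual
  compile-correct : ∀ {m} {f : PR m} {xs y st a} → f [ xs ]⇓ y → Args st a xs →
                    compile f a ⊢ st ⇒ y ∷ st
  compile-correct ⇓zero A = push0
  compile-correct ⇓succ (p ∷ []) = dup-correct p ⨾ inc []
  compile-correct (⇓proj {i = i}) A = dup-correct (Args-lookup A i)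
  compile-correct {st = st} (⇓comp {ys = ys} {y = y} gs f) A =
    compile*-correct gs A ⨾ compile-correct f (Args-iota ys st) ⨾ delUnder-correct y ys st
  compile-correct {y = y} {st} {a = k ∷ᵥ a} d@(⇓rec0 {f = f} {g} {xs} _) (p ∷ A) =
    compile-rec d p A
  compile-correct {y = y} {st} {a = k ∷ᵥ a} d@(⇓recS _ _) (p ∷ A) = compile-rec d p A
  compile-correct {st = st} {a = a} (⇓min {f = f} {xs} {y} f0 below) A =
    push0 ⨾ proj₂ (value 0 y refl) ⨾ search 0 y refl ⨾ del []
    where
    F : Prog
    F = compile f (0 ∷ᵥ mapᵥ suc a)

    args : ∀ z → Args (z ∷ st) (0 ∷ᵥ mapᵥ suc a) (z ∷ᵥ xs)
    args z = nthZ ∷ Args-map nthS A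

    below' : ∀ z d → z + suc d ≡ y → Σ ℕ λ k → F ⊢ z ∷ st ⇒ suc k ∷ z ∷ st
    below' z d eq = proj₁ (below z le) , compile-correct (proj₂ (below z le)) (args z)
      where
      le : suc z ≤ y
      le = subst (suc z ≤_) (trans (sym (+-suc z d)) eq) (m≤m+n (suc z) d)

    value : ∀ z d → z + d ≡ y → Σ ℕ λ v → F ⊢ z ∷ st ⇒ v ∷ z ∷ st
    value z zero eq with refl ← trans (sym (+-identityʳ z)) eq = 0 , compile-correct f0 (args z)
    value z (suc d) eq with below' z d eq
    ... | k , r = suc k , r

    -- The nonzero values below `y` are only known to exist, so the number tested at `z` is named
    -- through `value`. The recursion is on the distance `d` to `y`.
    search : ∀ z d (eq : z + d ≡ y) →
             while 0 (del 0 ⨾ inc 0 ⨾ F) ⊢ proj₁ (value z d eq) ∷ z ∷ st ⇒ 0 ∷ y ∷ st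
    search z zero eq with refl ← trans (sym (+-identityʳ z)) eq = exit []
    search z (suc d) eq =
      loop [] (del [] ⨾ inc [] ⨾ proj₂ (value (suc z) d eq')) (search (suc z) d eq')
      where
      eq' : suc z + d ≡ y
      eq' = trans (sym (+-suc z d)) eq

  compile-rec : ∀ {m} {f : PR m} {g x xs y st k a} → recᶠ f g [ x ∷ᵥ xs ]⇓ y →
                Nth st k x → Args st a xs → compile (recᶠ f g) (k ∷ᵥ a) ⊢ st ⇒ y ∷ st
  compile-rec {f = f} {g} {x} {xs} {y} {st} {k} {a} d p A with iterate d 0
    where
    body : Prog
    body = compile g (2 ∷ᵥ 0 ∷ᵥ mapᵥ (3 +_) a) ⨾ del 1 ⨾ inc 2

    -- A derivation for `recᶠ` exposes the last iteration first, whereas the loop performs it last.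
    -- The remaining loop is therefore passed as a continuation, with `r` counting the iterations
    -- already peeled off.
    iterate : ∀ {x y} → recᶠ f g [ x ∷ᵥ xs ]⇓ y → ∀ r {st'} →
              Σ ℕ λ y₀ → (∀ r → compile f (mapᵥ (2 +_) a) ⊢ r ∷ 0 ∷ st ⇒ y₀ ∷ r ∷ 0 ∷ st) ×
              (while 1 body ⊢ y ∷ r ∷ x ∷ st ⇒ st' → while 1 body ⊢ y₀ ∷ x + r ∷ 0 ∷ st ⇒ st')
    iterate (⇓rec0 {y = y} d) r =
      y , (λ r → compile-correct d (Args-map (λ p → nthS (nthS p)) A)) , λ w → w
    iterate (⇓recS {x = x} {y = y} {z = z} d e) r {st'} with iterate d (suc r) {st'}
    ... | y₀ , f₀ , w₀ = y₀ , f₀ , λ w →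
      subst (λ n → while 1 body ⊢ y₀ ∷ n ∷ 0 ∷ st ⇒ st') (+-suc x r)
        (w₀ (loop (y ∷ []) (compile-correct e (nthS (nthS nthZ) ∷ nthZ ∷
                               Args-map (λ p → nthS (nthS (nthS p))) A)
               ⨾ del (z ∷ []) ⨾ inc (z ∷ r ∷ [])) w))
  ... | y₀ , f₀ , w₀ = push0 ⨾ dup-correct (nthS p) ⨾ f₀ x ⨾
    subst (λ n → while 1 _ ⊢ y₀ ∷ n ∷ 0 ∷ st ⇒ y ∷ 0 ∷ x ∷ st) (+-identityʳ x)
      (w₀ (exit (y ∷ []))) ⨾
    del (y ∷ []) ⨾ del (y ∷ [])

  compile*-correct : ∀ {m n} {gs : Vec (PR n) m} {xs ys st a} → gs [ xs ]⇓* ys → Args st a xs →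
                     compile* gs a ⊢ st ⇒ toList ys ++ st
  compile*-correct ⇓[] A = skip
  compile*-correct (⇓∷ {ys = ys} g gs) A =
    compile*-correct gs A ⨾ compile-correct g (Args-map (Nth-++ ys) A)

-- The machine accepting the inputs on which a function is 1

module _ (g : PR 1) where

  prog : Prog
  prog = compile g (0 ∷ᵥ []ᵥ)

  exit₀ : ℕ
  exit₀ = exitPos 0 prog

  -- If the result is 0, `decOr` jumps to `3 + exit₀`, the first position past the code, where the
  -- machine is stuck; otherwise it goes on to `halt`.
  acceptor : Code
  acceptor = assemble 0 prog ++ decOr (3 + exit₀) ∷ copyRest ∷ halt ∷ []

  acceptor-loaded : Loaded acceptor 0 (assemble 0 prog) ×
                    Loaded acceptor exit₀ (decOr (3 + exit₀) ∷ copyRest ∷ halt ∷ [])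
  acceptor-loaded = Loaded-assemble 0 prog (Loaded-refl acceptor)

  acceptor-length : length acceptor ≡ 3 + exit₀
  acceptor-length = trans (sym (+-identityʳ _)) (trans (sym (advance-length 0 acceptor))
    (trans (advance-++ 0 (assemble 0 prog) _) (cong (3 +_) (advance-assemble 0 prog))))

  acceptor-run : ∀ {x y} → g [ x ∷ᵥ []ᵥ ]⇓ y →
    Steps acceptor (0 , block x [] , []) (exit₀ , block y (block x []) , [])
  acceptor-run {x} d =
    assemble-correct 0 prog (proj₁ acceptor-loaded) (compile-correct {st = x ∷ []} d (nthZ ∷ []))

  accepted-word : ∀ {x} → g [ x ∷ᵥ []ᵥ ]⇓ 1 →
    Σ Word λ w → Path acceptor 0 w × Good (block x []) [] w
  accepted-word d with acceptor-loaded
  ... | _ , a , b , c , _ = run⇒word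
    (acceptor-run d ◅◅ (fire a (here refl) (move (del one)) ◅ copyRest-steps b _ _)) c

  no-accepted-word : ∀ {x w} → g [ x ∷ᵥ []ᵥ ]⇓ 0 → Path acceptor 0 w → ¬ Good (block x []) [] w
  no-accepted-word d with acceptor-loaded
  ... | _ , a , _ = stuck⇒¬word
    (acceptor-run d ◅◅ (fire a (there (here refl)) (move (cp sep)) ◅ ε))
    λ x at → <-irrefl (sym acceptor-length) (At-length at)

-- Arithmetic with μ-recursive functions

_computes_ : ∀ {n} → PR n → (Vec ℕ n → ℕ) → Set
f computes F = ∀ xs → f [ xs ]⇓ F xs

constᶠ : ∀ {n} → ℕ → PR n
constᶠ zero    = zeroᶠ
constᶠ (suc c) = compᶠ succᶠ (constᶠ c ∷ᵥ []ᵥ)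

const-computes : ∀ {n} c → constᶠ {n} c computes λ _ → c
const-computes zero    xs = ⇓zero
const-computes (suc c) xs = ⇓comp (⇓∷ (const-computes c xs) ⇓[]) ⇓succ

proj-computes : ∀ {n} i → projᶠ {n} i computes λ xs → lookup xs i
proj-computes i xs = ⇓proj

comp₁-computes : ∀ {n} {h : PR 1} {H : ℕ → ℕ} {f : PR n} {F} →
  (∀ x → h [ x ∷ᵥ []ᵥ ]⇓ H x) → f computes F → compᶠ h (f ∷ᵥ []ᵥ) computes λ xs → H (F xs)
comp₁-computes h f xs = ⇓comp (⇓∷ (f xs) ⇓[]) (h _)

comp₂-computes : ∀ {n} {h : PR 2} {H : ℕ → ℕ → ℕ} {f g : PR n} {F G} →
  (∀ x y → h [ x ∷ᵥ y ∷ᵥ []ᵥ ]⇓ H x y) → f computes F → g computes G →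
  compᶠ h (f ∷ᵥ g ∷ᵥ []ᵥ) computes λ xs → H (F xs) (G xs)
comp₂-computes h f g xs = ⇓comp (⇓∷ (f xs) (⇓∷ (g xs) ⇓[])) (h _ _)

addᶠ mulᶠ pairᶠ : PR 2
addᶠ = recᶠ (projᶠ fzero) (compᶠ succᶠ (projᶠ (fsuc fzero) ∷ᵥ []ᵥ))
mulᶠ = recᶠ zeroᶠ (compᶠ addᶠ (projᶠ (fsuc (fsuc fzero)) ∷ᵥ projᶠ (fsuc fzero) ∷ᵥ []ᵥ))

pow2ᶠ : PR 1
pow2ᶠ = recᶠ (constᶠ 1) (compᶠ mulᶠ (constᶠ 2 ∷ᵥ projᶠ (fsuc fzero) ∷ᵥ []ᵥ))

pairᶠ = compᶠ mulᶠ (compᶠ pow2ᶠ (projᶠ fzero ∷ᵥ []ᵥ) ∷ᵥ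
                    compᶠ succᶠ (compᶠ mulᶠ (constᶠ 2 ∷ᵥ projᶠ (fsuc fzero) ∷ᵥ []ᵥ) ∷ᵥ []ᵥ) ∷ᵥ []ᵥ)

add-computes : ∀ x y → addᶠ [ x ∷ᵥ y ∷ᵥ []ᵥ ]⇓ (x + y)
add-computes zero    y = ⇓rec0 ⇓proj
add-computes (suc x) y = ⇓recS (add-computes x y) (⇓comp (⇓∷ ⇓proj ⇓[]) ⇓succ)

mul-computes : ∀ x y → mulᶠ [ x ∷ᵥ y ∷ᵥ []ᵥ ]⇓ (x * y)
mul-computes zero    y = ⇓rec0 ⇓zero
mul-computes (suc x) y =
  ⇓recS (mul-computes x y) (⇓comp (⇓∷ ⇓proj (⇓∷ ⇓proj ⇓[])) (add-computes y (x * y)))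

pow2-computes : ∀ x → pow2ᶠ [ x ∷ᵥ []ᵥ ]⇓ (2 ^ x)
pow2-computes zero    = ⇓rec0 (const-computes 1 _)
pow2-computes (suc x) =
  ⇓recS (pow2-computes x) (comp₂-computes mul-computes (const-computes 2) (proj-computes (fsuc fzero)) _)

pair-computes : ∀ x y → pairᶠ [ x ∷ᵥ y ∷ᵥ []ᵥ ]⇓ ⟪ x , y ⟫
pair-computes x y = comp₂-computes mul-computes
  (comp₁-computes pow2-computes (proj-computes fzero))
  (comp₁-computes (λ _ → ⇓succ)
    (comp₂-computes mul-computes (const-computes 2) (proj-computes (fsuc fzero))))
  (x ∷ᵥ y ∷ᵥ []ᵥ)

⟪_,_⟫ᶠ : ∀ {n} → PR n → PR n → PR n
⟪ f , g ⟫ᶠ = compᶠ pairᶠ (f ∷ᵥ g ∷ᵥ []ᵥ)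

-- Heap cells

data Cell : Set where
  fin : Cell
  _▹_ : ℕ → Token → Cell

bits : Token → Bool × Bool × Bool
bits end         = false , false , false
bits ⟨ nop ⟩     = false , false , true
bits ⟨ cp one ⟩  = false , true , false
bits ⟨ cp sep ⟩  = false , true , true
bits ⟨ put one ⟩ = true , false , false
bits ⟨ put sep ⟩ = true , false , true
bits ⟨ del one ⟩ = true , true , false
bits ⟨ del sep ⟩ = true , true , true

token : Bool → Bool → Bool → Token
token false false false = end
token false false true  = ⟨ nop ⟩
token false true  false = ⟨ cp one ⟩
token false true  true  = ⟨ cp sep ⟩
token true  false false = ⟨ put one ⟩
token true  false true  = ⟨ put sep ⟩
token true  true  false = ⟨ del one ⟩
token true  true  true  = ⟨ del sep ⟩

token-bits : ∀ t → token (proj₁ (bits t)) (proj₁ (proj₂ (bits t))) (proj₂ (proj₂ (bits t))) ≡ t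
token-bits end         = refl
token-bits ⟨ nop ⟩     = refl
token-bits ⟨ cp one ⟩  = refl
token-bits ⟨ cp sep ⟩  = refl
token-bits ⟨ put one ⟩ = refl
token-bits ⟨ put sep ⟩ = refl
token-bits ⟨ del one ⟩ = refl
token-bits ⟨ del sep ⟩ = refl

flag : ∀ {A : Set} → A → A → Bool → A
flag a b true  = a
flag a b false = b

-- The first field is the successor. The other three are the bits of the token, each given by the
-- successor again or by `⊥`, so that a cell mentions at most one further variable and none that
-- would need its own allocation.
layout : ∀ {A : Set} → (ℕ → A) → A → Cell → Vec A 4
layout f b fin     = b ∷ᵥ b ∷ᵥ b ∷ᵥ b ∷ᵥ []ᵥ
layout f b (n ▹ t) with bits t
... | b₁ , b₂ , b₃ = f n ∷ᵥ flag (f n) b b₁ ∷ᵥ flag (f n) b b₂ ∷ᵥ flag (f n) b b₃ ∷ᵥ []ᵥ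

fields : Cell → Vec VT 4
fields = layout var ⊥ᵥ

contents : Cell → Vec Loc 4
contents = layout just nothing

evalCell : Store → Cell → Cell
evalCell s fin     = fin
evalCell s (n ▹ t) = s n ▹ t

eval-flag : ∀ s n b → ⟦ flag (var n) ⊥ᵥ b ⟧ s ≡ flag (just (s n)) nothing b
eval-flag s n true  = refl
eval-flag s n false = refl

eval-fields : ∀ s c → mapᵥ (λ y → ⟦ y ⟧ s) (fields c) ≡ contents (evalCell s c)
eval-fields s fin = refl
eval-fields s (n ▹ t) with bits t
... | b₁ , b₂ , b₃ rewrite eval-flag s n b₁ | eval-flag s n b₂ | eval-flag s n b₃ = refl

decode : Vec Loc 4 → Cell
decode (just n ∷ᵥ a ∷ᵥ b ∷ᵥ c ∷ᵥ []ᵥ) = n ▹ token (is-just a) (is-just b) (is-just c)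
decode _ = fin

is-just-flag : ∀ (n : ℕ) b → is-just (flag (just n) nothing b) ≡ b
is-just-flag n true  = refl
is-just-flag n false = refl

decode-contents : ∀ c → decode (contents c) ≡ c
decode-contents fin = refl
decode-contents (n ▹ t) with bits t | token-bits t
... | b₁ , b₂ , b₃ | eq
  rewrite is-just-flag n b₁ | is-just-flag n b₂ | is-just-flag n b₃ = cong (n ▹_) eq

-- Heaps

-- The Split relation and heap inclusion unfold to Π-types, from which Agda cannot
-- recover the heaps; the record wrappers make these arguments inferable.
record _≑_⊎_ (h h₁ h₂ : Heap 4) : Set where
  constructor splits
  field split : Split 4 h h₁ h₂
open _≑_⊎_

record _⊆_ (h H : Heap 4) : Set where
  constructor sub
  field at : ∀ {l v} → cell h l ≡ just v → cell H l ≡ just v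
open _⊆_

record _at_stores_ (h : Heap 4) (x : ℕ) (c : Cell) : Set where
  constructor stored
  field value : cell h x ≡ just (contents c)

record Single (h : Heap 4) (x : ℕ) (c : Cell) : Set where
  constructor single
  field
    stored-at : h at x stores c
    only      : ∀ l → l ≢ x → cell h l ≡ nothing
open Single

stores-injective : ∀ {h x c c'} → h at x stores c → h at x stores c' → c ≡ c'
stores-injective {c = c} {c'} (stored p) (stored q) = trans (sym (decode-contents c))
  (trans (cong decode (just-injective (trans (sym p) q))) (decode-contents c'))

stores-⊆ : ∀ {h H x c} → h ⊆ H → h at x stores c → H at x stores c
stores-⊆ i (stored e) = stored (at i e)

⊆-refl : ∀ {h} → h ⊆ h
⊆-refl = sub λ e → e

⊎-⊆ˡ : ∀ {h h₁ h₂ H} → h ≑ h₁ ⊎ h₂ → h ⊆ H → h₁ ⊆ H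
at (⊎-⊆ˡ sp i) {l} e with split sp l
... | inj₁ (e' , _) with () ← trans (sym e) e'
... | inj₂ (_ , e') = at i (trans e' e)

⊎-comm : ∀ {h h₁ h₂} → h ≑ h₁ ⊎ h₂ → h ≑ h₂ ⊎ h₁
⊎-comm sp = splits λ l → [ inj₂ , inj₁ ] (split sp l)

⊎-⊆ʳ : ∀ {h h₁ h₂ H} → h ≑ h₁ ⊎ h₂ → h ⊆ H → h₂ ⊆ H
⊎-⊆ʳ sp = ⊎-⊆ˡ (⊎-comm sp)

_∪_ : Heap 4 → Heap 4 → Heap 4
cell (h₁ ∪ h₂) l = cell h₁ l <∣> cell h₂ l
finite (h₁ ∪ h₂) with finite h₁ | finite h₂
... | b₁ , p₁ | b₂ , p₂ = b₁ ⊔ b₂ , λ l b≤l →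
  cong₂ _<∣>_ (p₁ l (≤-trans (m≤m⊔n b₁ b₂) b≤l)) (p₂ l (≤-trans (m≤n⊔m b₁ b₂) b≤l))

∪-⊎ : ∀ h₁ h₂ → (∀ l → cell h₁ l ≡ nothing ⊎ cell h₂ l ≡ nothing) → (h₁ ∪ h₂) ≑ h₁ ⊎ h₂
split (∪-⊎ h₁ h₂ d) l with cell h₁ l | cell h₂ l | d l
... | nothing | m       | _ = inj₁ (refl , refl)
... | just v  | nothing | _ = inj₂ (refl , refl)
... | just _  | just _  | inj₁ ()
... | just _  | just _  | inj₂ ()

<∣>-nothing : ∀ {A : Set} (m : Maybe A) {m'} → m' ≡ nothing → (m <∣> m') ≡ m
<∣>-nothing m refl = <∣>-identityʳ m

⊎-assoc : ∀ {h h₁ h₂₃ h₂ h₃} → h ≑ h₁ ⊎ h₂₃ → h₂₃ ≑ h₂ ⊎ h₃ →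
          Σ (Heap 4) λ h₁₂ → h ≑ h₁₂ ⊎ h₃ × h₁₂ ≑ h₁ ⊎ h₂
⊎-assoc {h} {h₁} {h₂₃} {h₂} {h₃} sp sp' = h₁ ∪ h₂ , splits outer , ∪-⊎ h₁ h₂ disjoint
  where
  disjoint : ∀ l → cell h₁ l ≡ nothing ⊎ cell h₂ l ≡ nothing
  disjoint l with split sp l | split sp' l
  ... | inj₁ (p , _) | _            = inj₁ p
  ... | inj₂ _       | inj₁ (q , _) = inj₂ q
  ... | inj₂ (p , _) | inj₂ (_ , q) = inj₂ (trans (sym q) p)

  outer : Split 4 h (h₁ ∪ h₂) h₃
  outer l with split sp l | split sp' l
  ... | inj₁ (p , e) | inj₁ (q , e') = inj₁ (cong₂ _<∣>_ p q , trans e e')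
  ... | inj₁ (p , e) | inj₂ (q , e') =
    inj₂ (q , trans e (trans e' (sym (cong (_<∣> cell h₂ l) p))))
  ... | inj₂ (p , e) | inj₁ (q , e') =
    inj₂ (trans (sym e') p , trans e (sym (<∣>-nothing (cell h₁ l) q)))
  ... | inj₂ (p , e) | inj₂ (q , e') =
    inj₂ (q , trans e (sym (<∣>-nothing (cell h₁ l) (trans (sym e') p))))

⊎-assocʳ : ∀ {h h₁ h₁₂ h₂ h₃} → h ≑ h₁₂ ⊎ h₃ → h₁₂ ≑ h₁ ⊎ h₂ →
           Σ (Heap 4) λ h₂₃ → h ≑ h₁ ⊎ h₂₃ × h₂₃ ≑ h₂ ⊎ h₃
⊎-assocʳ sp sp' with ⊎-assoc (⊎-comm sp) (⊎-comm sp')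
... | h₂₃ , p , q = h₂₃ , ⊎-comm p , ⊎-comm q

⊎-emptyʳ : ∀ {h h₁ h₂ h₃ h₄} → h ≑ h₁ ⊎ h₂ → h₂ ≑ h₃ ⊎ h₄ → EmptyHeap 4 h₄ → h ≑ h₁ ⊎ h₃
⊎-emptyʳ {h₂ = h₂} {h₃} sp sp' e = splits λ l → [ (λ (p , q) → inj₁ (p , trans q (same-cell l)))
                                              , (λ (p , q) → inj₂ (trans (sym (same-cell l)) p , q)) ]
                                            (split sp l)
  where
  same-cell : ∀ l → cell h₂ l ≡ cell h₃ l
  same-cell l with split sp' l
  ... | inj₁ (p , q) = trans q (trans (e l) (sym p))
  ... | inj₂ (_ , q) = q

∅ : Heap 4
cell ∅ _ = nothing
finite ∅ = 0 , λ _ _ → refl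

⊎-∅ : ∀ {h} → h ≑ h ⊎ ∅
⊎-∅ = splits λ _ → inj₂ (refl , refl)

-- The rules

-- `compare` moves in the first block, and `expect s` moves in the second until it meets the symbol
-- `s` just written. A rule allocates its first parameter, so the two predicates take the threads in
-- opposite order. Their third parameter is the guessed start of the second block, checked against
-- the successor of the `end` of the first. `ended` looks for a surplus symbol in the second block;
-- `rest` and `list` consume the cells that remain.
data Symbol : Set where
  state              : ℕ → Symbol
  walk list ended rest compare : Symbol
  expect             : Sym → Symbol

toPS : Symbol → PredSym
toPS walk         = psym 0 1
toPS list         = psym 1 1
toPS ended        = psym 2 1
toPS rest         = psym 3 2
toPS compare      = psym 4 3
toPS (expect one) = psym 5 3
toPS (expect sep) = psym 6 3
toPS (state q)    = psym (7 + q) 1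

-- A left inverse yields the injectivity of `toPS` without comparing all pairs of symbols.
fromPS : PredSym → Symbol
fromPS (psym 0 _) = walk
fromPS (psym 1 _) = list
fromPS (psym 2 _) = ended
fromPS (psym 3 _) = rest
fromPS (psym 4 _) = compare
fromPS (psym 5 _) = expect one
fromPS (psym 6 _) = expect sep
fromPS (psym (suc (suc (suc (suc (suc (suc (suc q))))))) _) = state q

fromPS-toPS : ∀ P → fromPS (toPS P) ≡ P
fromPS-toPS walk         = refl
fromPS-toPS list         = refl
fromPS-toPS ended        = refl
fromPS-toPS rest         = refl
fromPS-toPS compare      = refl
fromPS-toPS (expect one) = refl
fromPS-toPS (expect sep) = refl
fromPS-toPS (state q)    = refl

toPS-injective : ∀ {P Q} → toPS P ≡ toPS Q → P ≡ Q
toPS-injective {P} {Q} e = trans (sym (fromPS-toPS P)) (trans (cong fromPS e) (fromPS-toPS Q))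

arity : Symbol → ℕ
arity (state _)  = 1
arity walk       = 1
arity list       = 1
arity ended      = 1
arity rest       = 2
arity compare    = 3
arity (expect _) = 3

formals : Symbol → List Var
formals P = upTo (arity P)

Call : Set
Call = Symbol × List Var

callAtom : Call → Atom 4
callAtom (P , us) = pred (toPS P) us

mkRule : Symbol → Cell → List Call → Rule 4
mkRule P c calls = rule (toPS P) (formals P) ((0 ↦ fields c) ∷ map callAtom calls)

-- Variables 0, 1, 2 are the formal parameters, 3 is the successor of the
-- allocated location and 4 the guessed start of the following block.
data IsRule (K : Code) : Symbol → Cell → List Call → Set where
  transition : ∀ {q x t q'} → At K q x → (t , q') ∈ choices q x →
          IsRule K (state q) (3 ▹ t) ((state q' , 3 ∷ []) ∷ [])
  final : ∀ {q} → At K q halt → IsRule K (state q) fin []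
  walk  : ∀ t → IsRule K walk (3 ▹ t) ((walk , 3 ∷ []) ∷ [])
  guess : IsRule K walk (3 ▹ end) ((compare , 3 ∷ 4 ∷ 4 ∷ []) ∷ [])
  list  : ∀ t → IsRule K list (3 ▹ t) ((list , 3 ∷ []) ∷ [])
  list-fin : IsRule K list fin []
  rest  : ∀ l → IsRule K rest (3 ▹ ⟨ l ⟩) ((rest , 3 ∷ 1 ∷ []) ∷ [])
  rest-end : IsRule K rest (1 ▹ end) []
  compare-skip : ∀ {l} → wr l ≡ nothing →
    IsRule K compare (3 ▹ ⟨ l ⟩) ((compare , 3 ∷ 1 ∷ 2 ∷ []) ∷ [])
  compare-sym : ∀ {l s} → wr l ≡ just s →
    IsRule K compare (3 ▹ ⟨ l ⟩) ((expect s , 1 ∷ 3 ∷ 2 ∷ []) ∷ [])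
  compare-end : IsRule K compare (2 ▹ end) ((ended , 1 ∷ []) ∷ [])
  expect-skip : ∀ {l s} → rd l ≡ nothing →
    IsRule K (expect s) (3 ▹ ⟨ l ⟩) ((expect s , 3 ∷ 1 ∷ 2 ∷ []) ∷ [])
  expect-same : ∀ {l s} → rd l ≡ just s →
    IsRule K (expect s) (3 ▹ ⟨ l ⟩) ((compare , 1 ∷ 3 ∷ 2 ∷ []) ∷ [])
  expect-diff : ∀ {l s s'} → rd l ≡ just s' → s ≢ s' →
    IsRule K (expect s) (3 ▹ ⟨ l ⟩) ((rest , 1 ∷ 2 ∷ []) ∷ (list , 3 ∷ []) ∷ [])
  expect-end : ∀ {s} → IsRule K (expect s) (3 ▹ end) ((rest , 1 ∷ 2 ∷ []) ∷ (list , 3 ∷ []) ∷ [])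
  ended-skip : ∀ {l} → rd l ≡ nothing → IsRule K ended (3 ▹ ⟨ l ⟩) ((ended , 3 ∷ []) ∷ [])
  ended-diff : ∀ {l s} → rd l ≡ just s → IsRule K ended (3 ▹ ⟨ l ⟩) ((list , 3 ∷ []) ∷ [])

letters : List Letter
letters = nop ∷ cp one ∷ cp sep ∷ put one ∷ put sep ∷ del one ∷ del sep ∷ []

∈letters : ∀ l → l ∈ letters
∈letters nop       = here refl
∈letters (cp one)  = there (here refl)
∈letters (cp sep)  = there (there (here refl))
∈letters (put one) = there (there (there (here refl)))
∈letters (put sep) = there (there (there (there (here refl))))
∈letters (del one) = there (there (there (there (there (here refl)))))
∈letters (del sep) = there (there (there (there (there (there (here refl))))))

compareCalls : Maybe Sym → List Call
compareCalls nothing  = (compare , 3 ∷ 1 ∷ 2 ∷ []) ∷ []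
compareCalls (just s) = (expect s , 1 ∷ 3 ∷ 2 ∷ []) ∷ []

expectCalls : Sym → Maybe Sym → List Call
expectCalls s nothing = (expect s , 3 ∷ 1 ∷ 2 ∷ []) ∷ []
expectCalls s (just s') with s ≟ˢ s'
... | yes _ = (compare , 1 ∷ 3 ∷ 2 ∷ []) ∷ []
... | no _  = (rest , 1 ∷ 2 ∷ []) ∷ (list , 3 ∷ []) ∷ []

endedCalls : Maybe Sym → List Call
endedCalls nothing  = (ended , 3 ∷ []) ∷ []
endedCalls (just _) = (list , 3 ∷ []) ∷ []

letterRules : Letter → SID 4
letterRules l =
  mkRule walk (3 ▹ ⟨ l ⟩) ((walk , 3 ∷ []) ∷ []) ∷
  mkRule list (3 ▹ ⟨ l ⟩) ((list , 3 ∷ []) ∷ []) ∷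
  mkRule rest (3 ▹ ⟨ l ⟩) ((rest , 3 ∷ 1 ∷ []) ∷ []) ∷
  mkRule compare (3 ▹ ⟨ l ⟩) (compareCalls (wr l)) ∷
  mkRule (expect one) (3 ▹ ⟨ l ⟩) (expectCalls one (rd l)) ∷
  mkRule (expect sep) (3 ▹ ⟨ l ⟩) (expectCalls sep (rd l)) ∷
  mkRule ended (3 ▹ ⟨ l ⟩) (endedCalls (rd l)) ∷ []

endRules : SID 4
endRules =
  mkRule walk (3 ▹ end) ((walk , 3 ∷ []) ∷ []) ∷
  mkRule walk (3 ▹ end) ((compare , 3 ∷ 4 ∷ 4 ∷ []) ∷ []) ∷
  mkRule list (3 ▹ end) ((list , 3 ∷ []) ∷ []) ∷
  mkRule list fin [] ∷
  mkRule rest (1 ▹ end) [] ∷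
  mkRule compare (2 ▹ end) ((ended , 1 ∷ []) ∷ []) ∷
  mkRule (expect one) (3 ▹ end) ((rest , 1 ∷ 2 ∷ []) ∷ (list , 3 ∷ []) ∷ []) ∷
  mkRule (expect sep) (3 ▹ end) ((rest , 1 ∷ 2 ∷ []) ∷ (list , 3 ∷ []) ∷ []) ∷ []

transRule : ℕ → Token × ℕ → Rule 4
transRule q (t , q') = mkRule (state q) (3 ▹ t) ((state q' , 3 ∷ []) ∷ [])

finalRules : ℕ → Instr → SID 4
finalRules q halt = mkRule (state q) fin [] ∷ []
finalRules q _    = []

codeRules : ℕ → Code → SID 4
codeRules q []      = []
codeRules q (x ∷ K) = (map (transRule q) (choices q x) ++ finalRules q x) ++ codeRules (suc q) K

rules : Code → SID 4
rules K = (concatMap letterRules letters ++ endRules) ++ codeRules 0 K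

-- Agreement of the list of rules with `IsRule`

Spec : Code → Rule 4 → Set
Spec K r = Σ Symbol λ P → Σ Cell λ c → Σ (List Call) λ calls →
           IsRule K P c calls × r ≡ mkRule P c calls

by : ∀ {K P c calls} → IsRule K P c calls → Spec K (mkRule P c calls)
by r = _ , _ , _ , r , refl

letterRules-sound : ∀ {K} l → All (Spec K) (letterRules l)
letterRules-sound {K} l =
  by (walk ⟨ l ⟩) ∷ by (list ⟨ l ⟩) ∷ by (rest l) ∷ comparing ∷ expecting one ∷ expecting sep ∷ ending ∷ []
  where
  comparing : Spec K (mkRule compare (3 ▹ ⟨ l ⟩) (compareCalls (wr l)))
  comparing with wr l in eq
  ... | nothing = by (compare-skip eq)
  ... | just s  = by (compare-sym eq)

  expecting : ∀ s → Spec K (mkRule (expect s) (3 ▹ ⟨ l ⟩) (expectCalls s (rd l)))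
  expecting s with rd l in eq
  ... | nothing = by (expect-skip eq)
  ... | just s' with s ≟ˢ s'
  ...   | yes refl = by (expect-same eq)
  ...   | no s≢s'  = by (expect-diff eq s≢s')

  ending : Spec K (mkRule ended (3 ▹ ⟨ l ⟩) (endedCalls (rd l)))
  ending with rd l in eq
  ... | nothing = by (ended-skip eq)
  ... | just s  = by (ended-diff eq)

endRules-sound : ∀ {K} → All (Spec K) endRules
endRules-sound = by (walk end) ∷ by guess ∷ by (list end) ∷ by list-fin ∷ by rest-end ∷
  by compare-end ∷ by (expect-end {s = one}) ∷ by (expect-end {s = sep}) ∷ []

codeRules-sound : ∀ {K} q f → Loaded K q f → All (Spec K) (codeRules q f)
codeRules-sound q [] _ = []
codeRules-sound {K} q (x ∷ f) (a , l) =
  All.++⁺ (All.++⁺ (All.map⁺ (All.tabulate λ m → by (transition a m))) (finals x a))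
          (codeRules-sound (suc q) f l)
  where
  finals : ∀ x → At K q x → All (Spec K) (finalRules q x)
  finals halt a      = by (final a) ∷ []
  finals copyBlock _ = []
  finals copyRest _  = []
  finals delBlock _  = []
  finals (put _) _   = []
  finals (decOr _) _ = []
  finals (goto _) _  = []

rules-sound : ∀ K → All (Spec K) (rules K)
rules-sound K = All.++⁺ (All.++⁺ (All.concat⁺ (All.map⁺ {xs = letters} (All.tabulate λ {l} _ → letterRules-sound l)))
                                 endRules-sound)
                        (codeRules-sound 0 K (Loaded-refl K))

codeRules-complete : ∀ {K q x r} i → At K q x →
  r ∈ map (transRule (i + q)) (choices (i + q) x) ++ finalRules (i + q) x → r ∈ codeRules i K
codeRules-complete {r = r} i (atZ {x} {c}) m = ∈-++⁺ˡ
  (subst (λ j → r ∈ map (transRule j) (choices j x) ++ finalRules j x) (+-identityʳ i) m)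
codeRules-complete {r = r} i (atS {x} {y} {q = q} a) m =
  ∈-++⁺ʳ (map (transRule i) (choices i y) ++ finalRules i y) (codeRules-complete (suc i) a
    (subst (λ j → r ∈ map (transRule j) (choices j x) ++ finalRules j x) (+-suc i q) m))

rules-complete : ∀ {K P c calls} → IsRule K P c calls → mkRule P c calls ∈ rules K
rules-complete {K} {P} {c} {calls} = go
  where
  ofLetter : ∀ {r} l → r ∈ letterRules l → r ∈ rules K
  ofLetter l m = ∈-++⁺ˡ {xs = concatMap letterRules letters ++ endRules}
    (∈-++⁺ˡ {xs = concatMap letterRules letters} (∈-concatMap⁺ letterRules {xs = letters} (lose (∈letters l) m)))

  ofEnd : ∀ {r} → r ∈ endRules → r ∈ rules K
  ofEnd m = ∈-++⁺ˡ {xs = concatMap letterRules letters ++ endRules} (∈-++⁺ʳ (concatMap letterRules letters) m)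

  ofCode : ∀ {r q x} → At K q x → r ∈ map (transRule q) (choices q x) ++ finalRules q x → r ∈ rules K
  ofCode a m = ∈-++⁺ʳ (concatMap letterRules letters ++ endRules) (codeRules-complete 0 a m)

  comparing : ∀ l m → wr l ≡ m → mkRule compare (3 ▹ ⟨ l ⟩) (compareCalls m) ∈ rules K
  comparing l _ refl = ofLetter l (there (there (there (here refl))))

  expecting : ∀ l s m → rd l ≡ m → mkRule (expect s) (3 ▹ ⟨ l ⟩) (expectCalls s m) ∈ rules K
  expecting l one _ refl = ofLetter l (there (there (there (there (here refl)))))
  expecting l sep _ refl = ofLetter l (there (there (there (there (there (here refl))))))

  ending : ∀ l m → rd l ≡ m → mkRule ended (3 ▹ ⟨ l ⟩) (endedCalls m) ∈ rules K
  ending l _ refl = ofLetter l (there (there (there (there (there (there (here refl)))))))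

  go : ∀ {P c calls} → IsRule K P c calls → mkRule P c calls ∈ rules K
  go (transition {q} a m)       = ofCode a (∈-++⁺ˡ (∈-map⁺ (transRule q) m))
  go (final a)                  = ofCode a (here refl)
  go (walk end)                 = ofEnd (here refl)
  go (walk ⟨ l ⟩)               = ofLetter l (here refl)
  go guess                      = ofEnd (there (here refl))
  go (list end)                 = ofEnd (there (there (here refl)))
  go (list ⟨ l ⟩)               = ofLetter l (there (here refl))
  go list-fin                   = ofEnd (there (there (there (here refl))))
  go (rest l)                   = ofLetter l (there (there (here refl)))
  go rest-end                   = ofEnd (there (there (there (there (here refl)))))
  go (compare-skip {l} eq)      = comparing l nothing eq
  go (compare-sym {l} {s} eq)   = comparing l (just s) eq
  go compare-end                = ofEnd (there (there (there (there (there (here refl))))))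
  go (expect-skip {l} {s} eq)   = expecting l s nothing eq
  go (expect-same {l} {s} eq) with expecting l s (just s) eq
  ... | m with s ≟ˢ s
  ...   | yes _  = m
  ...   | no s≢s = ⊥-elim (s≢s refl)
  go (expect-diff {l} {s} {s'} eq s≢s') with expecting l s (just s') eq
  ... | m with s ≟ˢ s'
  ...   | yes s≡s' = ⊥-elim (s≢s' s≡s')
  ...   | no _     = m
  go (expect-end {one})         = ofEnd (there (there (there (there (there (there (here refl)))))))
  go (expect-end {sep})         = ofEnd (there (there (there (there (there (there (there (here refl))))))))
  go (ended-skip {l} eq)        = ending l nothing eq
  go (ended-diff {l} {s} eq)    = ending l (just s) eq

-- Models of the rules

map-≡⇒Pointwise : ∀ {s s' : Store} xs us → map s' xs ≡ map s us → Pointwise (λ x u → s' x ≡ s u) xs us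
map-≡⇒Pointwise []       []       e = []
map-≡⇒Pointwise (x ∷ xs) (u ∷ us) e =
  ∷-injectiveˡ e ∷ map-≡⇒Pointwise xs us (∷-injectiveʳ e)

Pointwise⇒map-≡ : ∀ {s s' : Store} {xs us} → Pointwise (λ x u → s' x ≡ s u) xs us → map s' xs ≡ map s us
Pointwise⇒map-≡ []       = refl
Pointwise⇒map-≡ (e ∷ es) = cong₂ _∷_ e (Pointwise⇒map-≡ es)

-- Only pointers are followed and nothing is owned: both threads of the comparison read the same
-- heap `H`, whichever part of it their predicates allocate.
data Chain (H : Heap 4) : ℕ → Word → Set where
  stop : ∀ {x} → H at x stores fin → Chain H x []
  link : ∀ {x y t w} → H at x stores (y ▹ t) → Chain H y w → Chain H x (t ∷ w)

-- The contents of a cell determine token and successor, so a predicate that allocates `x` must read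
-- there what the chain reads.
follow : ∀ {h H x w y t} → Chain H x w → h ⊆ H → Single h x (y ▹ t) →
         Σ Word λ w' → w ≡ t ∷ w' × Chain H y w'
follow (stop e) i sg with () ← stores-injective e (stores-⊆ i (stored-at sg))
follow (link e c) i sg with refl ← stores-injective e (stores-⊆ i (stored-at sg)) = _ , refl , c

data Listed : Heap 4 → ℕ → Word → Set where
  stop : ∀ {h x} → Single h x fin → Listed h x []
  link : ∀ {h h₁ h₂ x y t w} → h ≑ h₁ ⊎ h₂ → Single h₁ x (y ▹ t) → Listed h₂ y w →
         Listed h x (t ∷ w)

listed⇒chain : ∀ {h H x w} → Listed h x w → h ⊆ H → Chain H x w
listed⇒chain (stop sg) i      = stop (stores-⊆ i (stored-at sg))
listed⇒chain (link sp sg L) i = link (stores-⊆ (⊎-⊆ˡ sp i) (stored-at sg)) (listed⇒chain L (⊎-⊆ʳ sp i))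

data Segment : Heap 4 → ℕ → Word → ℕ → Set where
  close : ∀ {h x z w} → Single h x (z ▹ end) → Segment h x (end ∷ w) z
  link  : ∀ {h h₁ h₂ x y l w z} → h ≑ h₁ ⊎ h₂ → Single h₁ x (y ▹ ⟨ l ⟩) → Segment h₂ y w z →
          Segment h x (⟨ l ⟩ ∷ w) z

-- The mismatch guarantees that `w` contains an `end` at which to cut: otherwise `after w` is empty,
-- and no mismatch has an empty word.
cut : ∀ {h x w o} → Listed h x w → Mismatch o (after w) →
      Σ (Heap 4) λ h₁ → Σ (Heap 4) λ h₂ → Σ ℕ λ z →
      h ≑ h₁ ⊎ h₂ × Segment h₁ x w z × Listed h₂ z (after w)
cut (stop _) ()
cut (link {t = end} sp sg L) m = _ , _ , _ , sp , close sg , L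
cut (link {t = ⟨ l ⟩} sp sg L) m with cut L m
... | h₁ , h₂ , z , sp' , S , L' with ⊎-assoc sp sp'
...   | h₃ , p , q = h₃ , h₂ , z , p , link q sg S , L'

store : ℕ → ℕ → ℕ → ℕ → ℕ → Store
store a b c d e 0 = a
store a b c d e 1 = b
store a b c d e 2 = c
store a b c d e 3 = d
store a b c d e _ = e

cellHeap : ℕ → Cell → Heap 4
cell (cellHeap x c) l with l ≟ x
... | yes _ = just (contents c)
... | no _  = nothing
finite (cellHeap x c) = suc x , outside
  where
  outside : ∀ l → suc x ≤ l → cell (cellHeap x c) l ≡ nothing
  outside l x<l with l ≟ x
  ... | yes refl = ⊥-elim (<-irrefl refl x<l)
  ... | no _     = refl

cellHeap-outside : ∀ x c l → l ≢ x → cell (cellHeap x c) l ≡ nothing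
cellHeap-outside x c l l≢x with l ≟ x
... | yes l≡x = ⊥-elim (l≢x l≡x)
... | no _    = refl

cellHeap-single : ∀ x c → Single (cellHeap x c) x c
cellHeap-single x c = single (stored value) (cellHeap-outside x c)
  where
  value : cell (cellHeap x c) x ≡ just (contents c)
  value with x ≟ x
  ... | yes _  = refl
  ... | no x≢x = ⊥-elim (x≢x refl)

listHeap : ∀ w x → Σ (Heap 4) λ h → Listed h x w × (∀ l → l < x → cell h l ≡ nothing)
listHeap [] x = cellHeap x fin , stop (cellHeap-single x fin) ,
                λ l l<x → cellHeap-outside x fin l (<⇒≢ l<x)
listHeap (t ∷ w) x with listHeap w (suc x)
... | h , L , below = cellHeap x c ∪ h , link (∪-⊎ _ _ disjoint) (cellHeap-single x c) L , below'
  where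
  c = suc x ▹ t

  disjoint : ∀ l → cell (cellHeap x c) l ≡ nothing ⊎ cell h l ≡ nothing
  disjoint l with l ≟ x
  ... | yes refl = inj₂ (below l (n<1+n l))
  ... | no _     = inj₁ refl

  below' : ∀ l → l < x → cell (cellHeap x c ∪ h) l ≡ nothing
  below' l l<x rewrite cellHeap-outside x c l (<⇒≢ l<x) = below l (<-trans l<x (n<1+n x))

-- Satisfaction of predicates as derivation trees

module _ (K : Code) where

  mutual
    -- Satisfaction freed from its encoding: rules are matched through `IsRule` and arguments are
    -- locations. The values of the formals are equated with `ls` rather than put into the index,
    -- which keeps pattern matching possible.
    data Tree : Heap 4 → Symbol → List ℕ → Set where
      node : ∀ {h h₁ h₂ P c calls ls} → IsRule K P c calls → (s : Store) → map s (formals P) ≡ ls →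
             h ≑ h₁ ⊎ h₂ → Single h₁ (s 0) (evalCell s c) → Trees h₂ s calls → Tree h P ls

    data Trees : Heap 4 → Store → List Call → Set where
      []  : ∀ {h s} → EmptyHeap 4 h → Trees h s []
      _∣_∷_ : ∀ {h h₁ h₂ s P us calls} → h ≑ h₁ ⊎ h₂ → Tree h₁ P (map s us) → Trees h₂ s calls →
            Trees h s ((P , us) ∷ calls)

  single⇒sat : ∀ {h s c} → Single h (s 0) (evalCell s c) → SatA 4 (rules K) s h (0 ↦ fields c)
  single⇒sat {s = s} {c} (single (stored e) o) = sat↦ (trans e (cong just (sym (eval-fields s c)))) o

  sat⇒single : ∀ {h s x c} → SatA 4 (rules K) s h (x ↦ fields c) → Single h (s x) (evalCell s c)
  sat⇒single {s = s} {c = c} (sat↦ e o) = single (stored (trans e (cong just (eval-fields s c)))) o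

  mutual
    tree⇒sat : ∀ {h P s us ls} → Tree h P ls → map s us ≡ ls → SatA 4 (rules K) s h (pred (toPS P) us)
    tree⇒sat {us = us} (node {P = P} {c} r s' e sp sg ts) e' =
      satP (mkRule P c _) (rules-complete r) refl s' (map-≡⇒Pointwise (formals P) us (trans e (sym e')))
        (sat∷ _ _ (split sp) (single⇒sat sg) (trees⇒sat ts))

    trees⇒sat : ∀ {h s calls} → Trees h s calls → SatL 4 (rules K) s h (map callAtom calls)
    trees⇒sat ([] e)         = sat[] e
    trees⇒sat (sp ∣ t ∷ ts)  = sat∷ _ _ (split sp) (tree⇒sat t refl) (trees⇒sat ts)

  mutual
    sat⇒tree : ∀ {h P s us} → SatA 4 (rules K) s h (pred (toPS P) us) → Tree h P (map s us)
    sat⇒tree {P = P} (satP r m e s' us body) with All.lookup (rules-sound K) m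
    ... | P' , c , calls , r' , refl with refl ← toPS-injective {P'} {P} e =
      body⇒tree r' s' (Pointwise⇒map-≡ us) body

    body⇒tree : ∀ {h P c calls ls} → IsRule K P c calls → (s : Store) → map s (formals P) ≡ ls →
                SatL 4 (rules K) s h ((0 ↦ fields c) ∷ map callAtom calls) → Tree h P ls
    body⇒tree {c = c} {calls} r s e (sat∷ h₁ h₂ sp sg ts) =
      node r s e (splits sp) (sat⇒single {c = c} sg) (sat⇒trees calls ts)

    sat⇒trees : ∀ {h s} calls → SatL 4 (rules K) s h (map callAtom calls) → Trees h s calls
    sat⇒trees []                 (sat[] e)         = [] e
    sat⇒trees ((P , us) ∷ calls) (sat∷ h₁ h₂ sp t ts) = splits sp ∣ sat⇒tree t ∷ sat⇒trees calls ts

  module _ {H : Heap 4} where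

    -- That z starts a chain is only known once the block before it has been read, so
    -- these lemmas have to precede the ones about the second thread.
    rest-after : ∀ {h x z w} → Tree h rest (x ∷ z ∷ []) → h ⊆ H → Chain H x w → Chain H z (after w)
    rest-after (node (rest l) s refl sp sg (sp' ∣ t ∷ _)) i c
      with _ , refl , c' ← follow c (⊎-⊆ˡ sp i) sg = rest-after t (⊎-⊆ˡ sp' (⊎-⊆ʳ sp i)) c'
    rest-after (node rest-end s refl sp sg _) i c
      with _ , refl , c' ← follow c (⊎-⊆ˡ sp i) sg = c'

    mutual
      compare-after : ∀ {h x y z w} → Tree h compare (x ∷ y ∷ z ∷ []) → h ⊆ H → Chain H x w →
                      Chain H z (after w)
      compare-after (node (compare-skip _) s refl sp sg (sp' ∣ t ∷ _)) i c
        with _ , refl , c' ← follow c (⊎-⊆ˡ sp i) sg = compare-after t (⊎-⊆ˡ sp' (⊎-⊆ʳ sp i)) c'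
      compare-after (node (compare-sym _) s refl sp sg (sp' ∣ t ∷ _)) i c
        with _ , refl , c' ← follow c (⊎-⊆ˡ sp i) sg = expect-after t (⊎-⊆ˡ sp' (⊎-⊆ʳ sp i)) c'
      compare-after (node compare-end s refl sp sg _) i c
        with _ , refl , c' ← follow c (⊎-⊆ˡ sp i) sg = c'

      expect-after : ∀ {h s x y z w} → Tree h (expect s) (y ∷ x ∷ z ∷ []) → h ⊆ H → Chain H x w →
                     Chain H z (after w)
      expect-after (node (expect-skip _) s refl sp sg (sp' ∣ t ∷ _)) i c =
        expect-after t (⊎-⊆ˡ sp' (⊎-⊆ʳ sp i)) c
      expect-after (node (expect-same _) s refl sp sg (sp' ∣ t ∷ _)) i c =
        compare-after t (⊎-⊆ˡ sp' (⊎-⊆ʳ sp i)) c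
      expect-after (node (expect-diff _ _) s refl sp sg (sp' ∣ t ∷ _)) i c =
        rest-after t (⊎-⊆ˡ sp' (⊎-⊆ʳ sp i)) c
      expect-after (node expect-end s refl sp sg (sp' ∣ t ∷ _)) i c =
        rest-after t (⊎-⊆ˡ sp' (⊎-⊆ʳ sp i)) c

    ended-mismatch : ∀ {h y v} → Tree h ended (y ∷ []) → h ⊆ H → Chain H y v → Mismatch [] v
    ended-mismatch (node (ended-skip eq) s refl sp sg (sp' ∣ t ∷ _)) i c
      with _ , refl , c' ← follow c (⊎-⊆ˡ sp i) sg =
        skip eq (ended-mismatch t (⊎-⊆ˡ sp' (⊎-⊆ʳ sp i)) c')
    ended-mismatch (node (ended-diff eq) s refl sp sg _) i c
      with _ , refl , c' ← follow c (⊎-⊆ˡ sp i) sg = long eq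

    mutual
      compare-mismatch : ∀ {h x y z w v} → Tree h compare (x ∷ y ∷ z ∷ []) → h ⊆ H →
                         Chain H x w → Chain H y v → Mismatch (written w) v
      compare-mismatch {v = v} (node (compare-skip {l} eq) s refl sp sg (sp' ∣ t ∷ _)) i c d
        with w , refl , c' ← follow c (⊎-⊆ˡ sp i) sg =
          subst (λ m → Mismatch (m ?∷ written w) v) (sym eq)
            (compare-mismatch t (⊎-⊆ˡ sp' (⊎-⊆ʳ sp i)) c' d)
      compare-mismatch {v = v} (node (compare-sym eq) s refl sp sg (sp' ∣ t ∷ _)) i c d
        with w , refl , c' ← follow c (⊎-⊆ˡ sp i) sg =
          subst (λ m → Mismatch (m ?∷ written w) v) (sym eq)
            (expect-mismatch t (⊎-⊆ˡ sp' (⊎-⊆ʳ sp i)) c' d)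
      compare-mismatch (node compare-end s refl sp sg (sp' ∣ t ∷ _)) i c d
        with _ , refl , c' ← follow c (⊎-⊆ˡ sp i) sg = ended-mismatch t (⊎-⊆ˡ sp' (⊎-⊆ʳ sp i)) d

      expect-mismatch : ∀ {h s x y z w v} → Tree h (expect s) (y ∷ x ∷ z ∷ []) → h ⊆ H →
                        Chain H x w → Chain H y v → Mismatch (s ∷ written w) v
      expect-mismatch (node (expect-skip eq) s refl sp sg (sp' ∣ t ∷ _)) i c d
        with _ , refl , d' ← follow d (⊎-⊆ˡ sp i) sg =
          skip eq (expect-mismatch t (⊎-⊆ˡ sp' (⊎-⊆ʳ sp i)) c d')
      expect-mismatch (node (expect-same eq) s refl sp sg (sp' ∣ t ∷ _)) i c d
        with _ , refl , d' ← follow d (⊎-⊆ˡ sp i) sg =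
          same eq (compare-mismatch t (⊎-⊆ˡ sp' (⊎-⊆ʳ sp i)) c d')
      expect-mismatch (node (expect-diff eq s≢s') s refl sp sg _) i c d
        with _ , refl , d' ← follow d (⊎-⊆ˡ sp i) sg = diff eq s≢s'
      expect-mismatch (node expect-end s refl sp sg _) i c d
        with _ , refl , d' ← follow d (⊎-⊆ˡ sp i) sg = short

    walk⇒faulty : ∀ {h x w} → Tree h walk (x ∷ []) → h ⊆ H → Chain H x w → Faulty w
    walk⇒faulty (node (walk _) s refl sp sg (sp' ∣ t ∷ _)) i c
      with _ , refl , c' ← follow c (⊎-⊆ˡ sp i) sg =
        later (walk⇒faulty t (⊎-⊆ˡ sp' (⊎-⊆ʳ sp i)) c')
    walk⇒faulty (node guess s refl sp sg (sp' ∣ t ∷ _)) i c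
      with _ , refl , c' ← follow c (⊎-⊆ˡ sp i) sg =
        -- The guess is both the second thread and the third argument, so `compare-after` shows that
        -- the second thread starts exactly where the block after the first one does.
        now (compare-mismatch t i' c' (compare-after t i' c'))
      where i' = ⊎-⊆ˡ sp' (⊎-⊆ʳ sp i)

  -- Trees from words

  one-tree : ∀ {h s P us} → Tree h P (map s us) → Trees h s ((P , us) ∷ [])
  one-tree t = ⊎-∅ ∣ t ∷ [] λ _ → refl

  list-tree : ∀ {h x w} → Listed h x w → Tree h list (x ∷ [])
  list-tree {x = x} (stop sg) = node list-fin (store x 0 0 0 0) refl ⊎-∅ sg ([] λ _ → refl)
  list-tree {x = x} (link {y = y} {t} sp sg L) =
    node (list t) (store x 0 0 y 0) refl sp sg (one-tree (list-tree L))

  rest-tree : ∀ {h x w z} → Segment h x w z → Tree h rest (x ∷ z ∷ [])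
  rest-tree {x = x} {z = z} (close sg) =
    node rest-end (store x z 0 0 0) refl ⊎-∅ sg ([] λ _ → refl)
  rest-tree {x = x} {z = z} (link {y = y} {l} sp sg S) =
    node (rest l) (store x z 0 y 0) refl sp sg (one-tree (rest-tree S))

  ended-tree : ∀ {h y v} → Mismatch [] v → Listed h y v → Tree h ended (y ∷ [])
  ended-tree {y = y} (skip eq m) (link {y = y'} sp sg L) =
    node (ended-skip eq) (store y 0 0 y' 0) refl sp sg (one-tree (ended-tree m L))
  ended-tree {y = y} (long eq) (link {y = y'} sp sg L) =
    node (ended-diff eq) (store y 0 0 y' 0) refl sp sg (one-tree (list-tree L))

  mutual
    -- The heap is split into what is left of the first block and the list from the second thread
    -- on. Each node takes its cell from the part whose thread moves; after a mismatch the leftovers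
    -- go to `rest` and `list`, so that every cell is consumed.
    compare-tree : ∀ {h h₁ h₂ x y z w v} → Mismatch (written w) v → Segment h₁ x w z →
                   Listed h₂ y v → h ≑ h₁ ⊎ h₂ → Tree h compare (x ∷ y ∷ z ∷ [])
    compare-tree {x = x} {y} {z} m (close sg) L sp =
      node compare-end (store x y z 0 0) refl sp sg (one-tree (ended-tree m L))
    compare-tree {x = x} {y} {z} m (link {y = x'} {l} {w} sp₁ sg S) L sp
      with h₃ , p , q ← ⊎-assocʳ sp sp₁ = read (wr l) refl m
      where
      read : ∀ s → wr l ≡ s → Mismatch (s ?∷ written w) _ → Tree _ compare (x ∷ y ∷ z ∷ [])
      read nothing eq m =
        node (compare-skip eq) (store x y z x' 0) refl p sg (one-tree (compare-tree m S L q))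
      read (just s) eq m =
        node (compare-sym eq) (store x y z x' 0) refl p sg (one-tree (expect-tree m S L q))

    expect-tree : ∀ {h h₁ h₂ s x y z w v} → Mismatch (s ∷ written w) v → Segment h₁ x w z →
                  Listed h₂ y v → h ≑ h₁ ⊎ h₂ → Tree h (expect s) (y ∷ x ∷ z ∷ [])
    expect-tree {x = x} {y} {z} (skip eq m) S (link {y = y'} sp₂ sg L) sp
      with h₃ , p , q ← ⊎-assocʳ (⊎-comm sp) sp₂ =
        node (expect-skip eq) (store y x z y' 0) refl p sg
          (one-tree (expect-tree m S L (⊎-comm q)))
    expect-tree {x = x} {y} {z} (same eq m) S (link {y = y'} sp₂ sg L) sp
      with h₃ , p , q ← ⊎-assocʳ (⊎-comm sp) sp₂ =
        node (expect-same eq) (store y x z y' 0) refl p sg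
          (one-tree (compare-tree m S L (⊎-comm q)))
    expect-tree {x = x} {y} {z} (diff eq s≢s') S (link {y = y'} sp₂ sg L) sp
      with h₃ , p , q ← ⊎-assocʳ (⊎-comm sp) sp₂ =
        node (expect-diff eq s≢s') (store y x z y' 0) refl p sg
          (⊎-comm q ∣ rest-tree S ∷ one-tree (list-tree L))
    expect-tree {x = x} {y} {z} short S (link {y = y'} sp₂ sg L) sp
      with h₃ , p , q ← ⊎-assocʳ (⊎-comm sp) sp₂ =
        node expect-end (store y x z y' 0) refl p sg
          (⊎-comm q ∣ rest-tree S ∷ one-tree (list-tree L))

  faulty⇒walk : ∀ {h x w} → Faulty w → Listed h x w → Tree h walk (x ∷ [])
  faulty⇒walk {x = x} (later {t} f) (link {y = y} sp sg L) =
    node (walk t) (store x 0 0 y 0) refl sp sg (one-tree (faulty⇒walk f L))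
  faulty⇒walk {x = x} (now m) (link {y = y} sp sg L) with cut L m
  ... | h₁ , h₂ , z , sp' , S , L' =
    node guess (store x 0 0 y z) refl sp sg (one-tree (compare-tree m S L' sp'))

  path⇒tree : ∀ {h x q w} → Path K q w → Listed h x w → Tree h (state q) (x ∷ [])
  path⇒tree {x = x} (stop a) (stop sg) =
    node (final a) (store x 0 0 0 0) refl ⊎-∅ sg ([] λ _ → refl)
  path⇒tree {x = x} (along a m p) (link {y = y} sp sg L) =
    node (transition a m) (store x 0 0 y 0) refl sp sg (one-tree (path⇒tree p L))

  tree⇒path : ∀ {h x q} → Tree h (state q) (x ∷ []) → Σ Word λ w → Path K q w × Listed h x w
  tree⇒path (node (transition a m) s refl sp sg (sp' ∣ t ∷ [] e)) with tree⇒path t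
  ... | w , p , L = _ , along a m p , link (⊎-emptyʳ sp sp' e) sg L
  tree⇒path (node (final a) s refl sp sg ([] e)) = [] , stop a , stop (single-⊎ sp e sg)
    where
    single-⊎ : ∀ {h h₁ h₂ x c} → h ≑ h₁ ⊎ h₂ → EmptyHeap 4 h₂ → Single h₁ x c → Single h x c
    single-⊎ {h} {h₁} sp e (single (stored p) o) =
      single (stored (trans (same-cell _) p)) λ l l≢x → trans (same-cell l) (o l l≢x)
      where
      same-cell : ∀ l → cell h l ≡ cell h₁ l
      same-cell l with split sp l
      ... | inj₁ (p , q) = trans q (trans (e l) (sym p))
      ... | inj₂ (_ , q) = q

-- The reduction

-- The equation moves the tail of the list back to variable 0, so that the number of
-- variables does not grow with the input.
emit : Token → Form 4 → Form 4
emit t ψ = ex 1 (atom (0 ↦ fields (1 ▹ t)) ∗ ex 0 (atom (0 ≈ 1) ∗ ψ))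

-- A block that only writes: the input `n` enters as the output of a pass that precedes the run of
-- the machine.
tape : ℕ → Form 4
tape zero    = emit ⟨ put sep ⟩ (emit end (atom (pred (toPS (state 0)) (0 ∷ []))))
tape (suc n) = emit ⟨ put one ⟩ (tape n)

tapeWord : ℕ → Word → Word
tapeWord zero    w = ⟨ put sep ⟩ ∷ end ∷ w
tapeWord (suc n) w = ⟨ put one ⟩ ∷ tapeWord n w

module _ (K : Code) where

  emit⁺ : ∀ t ψ {s h h₁ h₂ y} → h ≑ h₁ ⊎ h₂ → Single h₁ (s 0) (y ▹ t) →
          (∀ s' → s' 0 ≡ y → Sat 4 (rules K) s' h₂ ψ) → Sat 4 (rules K) s h (emit t ψ)
  emit⁺ t ψ {s} {h₁ = h₁} {h₂} {y} sp sg k = satEx y (sat∗ h₁ h₂ (split sp)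
    (satAtom (single⇒sat K {s = update s 1 y} {c = 1 ▹ t} sg))
    (satEx y (sat∗ ∅ h₂ (split (⊎-comm (⊎-∅ {h₂}))) (satAtom (sat≈ refl λ _ → refl)) (k _ refl))))

  emit⁻ : ∀ t ψ {s h} → Sat 4 (rules K) s h (emit t ψ) →
          Σ (Heap 4) λ h₁ → Σ (Heap 4) λ h₂ → Σ Store λ s' →
          h ≑ h₁ ⊎ h₂ × Single h₁ (s 0) (s' 0 ▹ t) × Sat 4 (rules K) s' h₂ ψ
  emit⁻ t ψ (satEx y (sat∗ h₁ h₂ sp (satAtom p) (satEx v (sat∗ h₃ h₄ sp' (satAtom (sat≈ refl e)) d)))) =
    h₁ , h₄ , _ , ⊎-emptyʳ {h₂ = h₂} {h₄} {h₃} (splits sp) (⊎-comm (splits sp')) e , sat⇒single K {c = 1 ▹ t} p , d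

  tape⁺ : ∀ n {s h w} → Path K 0 w → Listed h (s 0) (tapeWord n w) → Sat 4 (rules K) s h (tape n)
  tape⁺ zero p (link sp sg (link sp' sg' L)) = emit⁺ ⟨ put sep ⟩ _ sp sg λ { s' refl →
    emit⁺ end _ sp' sg' λ { s'' refl → satAtom (tree⇒sat K (path⇒tree K p L) refl) } }
  tape⁺ (suc n) p (link sp sg L) = emit⁺ ⟨ put one ⟩ (tape n) sp sg λ { s' refl → tape⁺ n p L }

  tape⁻ : ∀ n {s h} → Sat 4 (rules K) s h (tape n) →
          Σ Word λ w → Path K 0 w × Listed h (s 0) (tapeWord n w)
  tape⁻ zero d with emit⁻ ⟨ put sep ⟩ _ d
  ... | _ , _ , s' , sp , sg , d' with emit⁻ end _ d'
  ...   | _ , _ , s'' , sp' , sg' , satAtom p with tree⇒path K (sat⇒tree K {P = state 0} p)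
  ...     | w , path , L = w , path , link sp sg (link sp' sg' L)
  tape⁻ (suc n) d with emit⁻ ⟨ put one ⟩ (tape n) d
  ... | _ , _ , s' , sp , sg , d' with tape⁻ n d'
  ...   | w , path , L = w , path , link sp sg L

written-tape : ∀ n w → written (tapeWord n w) ≡ block n []
written-tape zero    w = refl
written-tape (suc n) w = cong (one ∷_) (written-tape n w)

after-tape : ∀ n w → after (tapeWord n w) ≡ w
after-tape zero    w = refl
after-tape (suc n) w = after-tape n w

faulty-tape : ∀ n {w} → Faulty w → Faulty (tapeWord n w)
faulty-tape zero    f = later (later f)
faulty-tape (suc n) f = later (faulty-tape n f)

faulty-after-tape : ∀ n {w} → Faulty (end ∷ w) → Faulty (tapeWord n w)
faulty-after-tape zero    f = later f
faulty-after-tape (suc n) f = later (faulty-after-tape n f)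

good-tape : ∀ n {o w} → Good (o ++ block n []) [] w → Good [] o (tapeWord n w)
good-tape zero    g = move (put sep) then (close then g)
good-tape (suc n) {o} {w} g = move (put one) then
  good-tape n (subst (λ i → Good i [] w) (sym (++-assoc o (one ∷ []) (block n []))) g)

-- `walk` selects a pair of blocks only right after an `end`; the leading one lets the tape be the
-- first block of a pair.
source : ℕ → Form 4
source n = emit end (tape n)

target : Form 4
target = atom (pred (toPS walk) (0 ∷ []))

instance-of : Code → ℕ → Problem 4
instance-of K n = problem (source n) target (rules K)

valid : ∀ K n → (∀ {w} → Path K 0 w → ¬ Good (block n []) [] w) → Valid 4 (instance-of K n)
valid K n none s h d with emit⁻ K end (tape n) d
... | _ , _ , s' , sp , sg , d' with tape⁻ K n d'
...   | w , p , L = satAtom (tree⇒sat K {s = s} (faulty⇒walk K faulty (link sp sg L)) refl)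
  where
  faulty : Faulty (end ∷ tapeWord n w)
  faulty with good-or-faulty (block n []) [] w
  ... | inj₁ g = ⊥-elim (none p g)
  -- The pairs of blocks in the three faults start after the leading `end`, after the `end` that
  -- closes the tape, and after an `end` of `w`.
  ... | inj₂ (inj₁ m) = now (subst₂ Mismatch (sym (written-tape n w)) (sym (after-tape n w)) m)
  ... | inj₂ (inj₂ (inj₁ m)) = later (faulty-after-tape n (now m))
  ... | inj₂ (inj₂ (inj₂ f)) = later (faulty-tape n f)

-- The list heap of the accepting word is a model of the left-hand side; if it satisfied the
-- right-hand side, a good word would be faulty.
invalid : ∀ K n {w} → Path K 0 w → Good (block n []) [] w → ¬ Valid 4 (instance-of K n)
invalid K n {w} p g v with listHeap (end ∷ tapeWord n w) 0
... | h , L@(link sp sg L') , _ with v (λ _ → 0) h (emit⁺ K end (tape n) sp sg λ { s' refl → tape⁺ K n p L' })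
...   | satAtom d = good⇒¬faulty (close then good-tape n g)
  (walk⇒faulty K (sat⇒tree K {P = walk} {us = 0 ∷ []} d) ⊆-refl (listed⇒chain L ⊆-refl))

-- Membership in the fragment

-- The first `owned P` parameters of P are allocated in every predicate-less unfolding.
owned : Symbol → ℕ
owned compare    = 2
owned (expect _) = 2
owned _          = 1

owners : List Call → List Var
owners = concatMap λ (P , us) → take (owned P) us

cellVars : Cell → List Var
cellVars fin     = []
cellVars (n ▹ _) = n ∷ []

-- A local, decidable check behind establishedness: existential variables, and owned parameters
-- other than the allocated 0, are passed to calls that own them. The last part concerns arities.
Covering : Symbol → Cell → List Call → Set
Covering P c calls =
  All (λ z → z ∈ formals P ⊎ z ∈ owners calls) (cellVars c ++ concatMap proj₂ calls) ×
  All (λ z → z ≡ 0 ⊎ z ∈ owners calls) (take (owned P) (formals P)) ×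
  All (λ (P , us) → length us ≡ arity P) calls

covering? : ∀ P c calls → Dec (Covering P c calls)
covering? P c calls =
  all? (λ z → (z ∈? formals P) ⊎-dec (z ∈? owners calls)) (cellVars c ++ concatMap proj₂ calls) ×-dec
  all? (λ z → (z ≟ 0) ⊎-dec (z ∈? owners calls)) (take (owned P) (formals P)) ×-dec
  all? (λ (P , us) → length us ≟ arity P) calls

-- The check does not depend on the token, the state numbers or the pending symbol, so it evaluates
-- to `yes` on each rule scheme.
covering : ∀ {K P c calls} → IsRule K P c calls → Covering P c calls
covering {P = P} {c} {calls} (transition _ _) = from-yes (covering? P c calls)
covering {P = P} {c} {calls} (final _)        = from-yes (covering? P c calls)
covering {P = P} {c} {calls} (walk _)         = from-yes (covering? P c calls)
covering {P = P} {c} {calls} guess            = from-yes (covering? P c calls)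
covering {P = P} {c} {calls} (list _)         = from-yes (covering? P c calls)
covering {P = P} {c} {calls} list-fin         = from-yes (covering? P c calls)
covering {P = P} {c} {calls} (rest _)         = from-yes (covering? P c calls)
covering {P = P} {c} {calls} rest-end         = from-yes (covering? P c calls)
covering {P = P} {c} {calls} (compare-skip _) = from-yes (covering? P c calls)
covering {P = P} {c} {calls} (compare-sym _)  = from-yes (covering? P c calls)
covering {P = P} {c} {calls} compare-end      = from-yes (covering? P c calls)
covering {P = P} {c} {calls} (expect-skip _)  = from-yes (covering? P c calls)
covering {P = P} {c} {calls} (expect-same _)  = from-yes (covering? P c calls)
covering {P = P} {c} {calls} (expect-diff _ _) = from-yes (covering? P c calls)
covering {P = P} {c} {calls} expect-end       = from-yes (covering? P c calls)
covering {P = P} {c} {calls} (ended-skip _)   = from-yes (covering? P c calls)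
covering {P = P} {c} {calls} (ended-diff _)   = from-yes (covering? P c calls)

body : Cell → List Call → List (Atom 4)
body c calls = (0 ↦ fields c) ∷ map callAtom calls

flag-vars : ∀ {z n} b {ys} → z ∈ vtVars 4 (flag (var n) ⊥ᵥ b ∷ ys) → z ≡ n ⊎ z ∈ vtVars 4 ys
flag-vars true  (here e)  = inj₁ e
flag-vars true  (there m) = inj₂ m
flag-vars false m         = inj₂ m

fields-vars : ∀ c {z} → z ∈ vtVars 4 (toList (fields c)) → z ∈ cellVars c
fields-vars (n ▹ t) m with bits t | m
... | b₁ , b₂ , b₃ | here e = here e
... | b₁ , b₂ , b₃ | there m₁ with flag-vars b₁ m₁
...   | inj₁ e = here e
...   | inj₂ m₂ with flag-vars b₂ m₂
...     | inj₁ e = here e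
...     | inj₂ m₃ with flag-vars b₃ m₃
...       | inj₁ e = here e

calls-vars : ∀ calls → listVars 4 (map callAtom calls) ≡ concatMap proj₂ calls
calls-vars []                 = refl
calls-vars ((_ , us) ∷ calls) = cong (us ++_) (calls-vars calls)

body-vars : ∀ c calls {z} → z ∈ listVars 4 (body c calls) → z ≡ 0 ⊎ z ∈ cellVars c ++ concatMap proj₂ calls
body-vars c calls (here e) = inj₁ e
body-vars c calls (there m) with ∈-++⁻ (vtVars 4 (toList (fields c))) m
... | inj₁ m' = inj₂ (∈-++⁺ˡ (fields-vars c m'))
... | inj₂ m' = inj₂ (∈-++⁺ʳ (cellVars c) (subst (_ ∈_) (calls-vars calls) m'))

-- The invariant of unfolding: the variable is allocated already, or owned by a pending call.
-- Without predicate atoms only the first alternative is left.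
Covered : Var → List (Atom 4) → Set
Covered z as = (Σ (Vec VT 4) λ ys → (z ↦ ys) ∈ as)
             ⊎ (Σ Symbol λ P → Σ (List Var) λ us → pred (toPS P) us ∈ as × z ∈ take (owned P) us)

owners-covered : ∀ {z} calls → z ∈ owners calls → ∀ c → Covered z (body c calls)
owners-covered ((P , us) ∷ calls) m c with ∈-++⁻ (take (owned P) us) m
... | inj₁ m' = inj₂ (P , us , there (here refl) , m')
... | inj₂ m' with owners-covered calls m' c
...   | inj₁ (ys , here e)    = inj₁ (ys , here e)
...   | inj₁ (ys , there i)   = inj₁ (ys , there (there i))
...   | inj₂ (P' , us' , there i , j) = inj₂ (P' , us' , there (there i) , j)

0∈formals : ∀ P → 0 ∈ formals P
0∈formals (state _)  = here refl
0∈formals walk       = here refl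
0∈formals list       = here refl
0∈formals ended      = here refl
0∈formals rest       = here refl
0∈formals compare    = here refl
0∈formals (expect _) = here refl

existentials-covered : ∀ {K P c calls z} → IsRule K P c calls → ExVar 4 (mkRule P c calls) z →
                       Covered z (body c calls)
existentials-covered {P = P} {c} {calls} r (m , z∉) with body-vars c calls m
... | inj₁ refl = ⊥-elim (z∉ (0∈formals P))
... | inj₂ m' with All.lookup (proj₁ (covering r)) m'
...   | inj₁ z∈ = ⊥-elim (z∉ z∈)
...   | inj₂ z∈ = owners-covered calls z∈ c

formals-covered : ∀ {K P c calls z} → IsRule K P c calls → z ∈ take (owned P) (formals P) →
                  Covered z (body c calls)
formals-covered {c = c} {calls} r m with All.lookup (proj₁ (proj₂ (covering r))) m
... | inj₁ refl = inj₁ (fields c , here refl)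
... | inj₂ z∈   = owners-covered calls z∈ c

Covered-rename : ∀ {z as} σ → Covered z as → Covered (σ z) (map (renameA 4 σ) as)
Covered-rename σ (inj₁ (ys , m)) = inj₁ (_ , ∈-map⁺ (renameA 4 σ) m)
Covered-rename {z} σ (inj₂ (P , us , m , i)) = inj₂ (P , map σ us , ∈-map⁺ (renameA 4 σ) m ,
  subst (σ z ∈_) (sym (take-map (owned P) us)) (∈-map⁺ σ i))

Covered-⊆ : ∀ {z as bs} → (∀ {a} → a ∈ as → a ∈ bs) → Covered z as → Covered z bs
Covered-⊆ f (inj₁ (ys , m))         = inj₁ (ys , f m)
Covered-⊆ f (inj₂ (P , us , m , i)) = inj₂ (P , us , f m , i)

Pointwise-map : ∀ {σ : Var → Var} {xs us} → Pointwise (λ x u → σ x ≡ u) xs us → map σ xs ≡ us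
Pointwise-map []       = refl
Pointwise-map (e ∷ es) = cong₂ _∷_ e (Pointwise-map es)

-- All atoms but the unfolded one survive. If that one owned `z`, then `z` is the image under `σ` of
-- an owned formal, and the rule body covers its owned formals.
unfold-covered : ∀ K {z as bs} → Unfold1 4 (rules K) as bs → Covered z as → Covered z bs
unfold-covered K {z} (unfold pre post p us r r∈ e σ pw _ _) = cov
  where
  new : List (Atom 4)
  new = map (renameA 4 σ) (Rule.body r)

  in-pre : ∀ {a} → a ∈ pre → a ∈ pre ++ new ++ post
  in-pre = ∈-++⁺ˡ

  in-new : ∀ {a} → a ∈ new → a ∈ pre ++ new ++ post
  in-new m = ∈-++⁺ʳ pre (∈-++⁺ˡ m)

  in-post : ∀ {a} → a ∈ post → a ∈ pre ++ new ++ post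
  in-post m = ∈-++⁺ʳ pre (∈-++⁺ʳ new m)

  replaced : ∀ P → toPS P ≡ p → z ∈ take (owned P) us → Covered z (pre ++ new ++ post)
  replaced P e' z∈ with All.lookup (rules-sound K) r∈
  ... | P' , c , calls , ir , refl with refl ← toPS-injective {P'} {P} (trans e (sym e'))
    with ∈-map⁻ σ (subst (z ∈_) (trans (cong (take (owned P)) (sym (Pointwise-map pw)))
                                       (take-map (owned P) (formals P))) z∈)
  ...   | x , x∈ , refl = Covered-⊆ in-new (Covered-rename σ (formals-covered ir x∈))

  cov : Covered z (pre ++ pred p us ∷ post) → Covered z (pre ++ new ++ post)
  cov (inj₁ (ys , m)) with ∈-++⁻ pre m
  ... | inj₁ m'         = inj₁ (ys , in-pre m')
  ... | inj₂ (there m') = inj₁ (ys , in-post m')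
  cov (inj₂ (P , us' , m , i)) with ∈-++⁻ pre m
  ... | inj₁ m'          = inj₂ (P , us' , in-pre m' , i)
  ... | inj₂ (there m')  = inj₂ (P , us' , in-post m' , i)
  ... | inj₂ (here refl) = replaced P refl i

unfolding-covered : ∀ K {z as bs} → Unfolding 4 (rules K) as bs → Covered z as → Covered z bs
unfolding-covered K ε        cov = cov
unfolding-covered K (u ◅ us) cov = unfolding-covered K us (unfold-covered K u cov)

established : ∀ {P c calls} K → IsRule K P c calls → Established 4 (rules K) (mkRule P c calls)
established K r z ez bs us np with unfolding-covered K us (existentials-covered r ez)
... | inj₁ (ys , m)          = z , EqChain.here , ys , m
... | inj₂ (P , us' , m , _) = ⊥-elim (All.lookup np m)

calls-NotPto : ∀ calls → All (NotPto 4) (map callAtom calls)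
calls-NotPto []      = []
calls-NotPto (_ ∷ c) = tt ∷ calls-NotPto c

formals-cons : ∀ P → Σ (List Var) λ rest → formals P ≡ 0 ∷ rest
formals-cons (state _)  = _ , refl
formals-cons walk       = _ , refl
formals-cons list       = _ , refl
formals-cons ended      = _ , refl
formals-cons rest       = _ , refl
formals-cons compare    = _ , refl
formals-cons (expect _) = _ , refl

progressing : ∀ P c calls → Progressing 4 (mkRule P c calls)
progressing P c calls = 0 , proj₁ (formals-cons P) , fields c , [] , map callAtom calls ,
  proj₂ (formals-cons P) , refl , calls-NotPto calls

connected : ∀ {K q c calls} → IsRule K (state q) c calls → Connected 4 (mkRule (state q) c calls)
connected (transition {t = t} _ _) = 0 , [] , fields (3 ▹ t) , [] , _ , refl , refl , tt ∷ [] ,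
  (3 , [] , refl , here refl) ∷ []
connected (final _) = 0 , [] , fields fin , [] , [] , refl , refl , [] , []

toPS-arity : ∀ P → PredSym.arity (toPS P) ≡ arity P
toPS-arity (state _)    = refl
toPS-arity walk         = refl
toPS-arity list         = refl
toPS-arity ended        = refl
toPS-arity rest         = refl
toPS-arity compare      = refl
toPS-arity (expect one) = refl
toPS-arity (expect sep) = refl

calls-WF : ∀ {calls} → All (λ (P , us) → length us ≡ arity P) calls → All (WFAtom 4) (map callAtom calls)
calls-WF []                     = []
calls-WF (_∷_ {x = P , _} e es) = trans e (sym (toPS-arity P)) ∷ calls-WF es

well-formed : ∀ {K P c calls} → IsRule K P c calls → WFRule 4 (mkRule P c calls)
well-formed {P = P} r = upTo⁺ (arity P) , trans (length-upTo (arity P)) (sym (toPS-arity P)) ,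
  tt ∷ calls-WF (proj₂ (proj₂ (covering r)))

rule-property : ∀ K (Q : Rule 4 → Set) → (∀ {P c calls} → IsRule K P c calls → Q (mkRule P c calls)) →
                ∀ r → r ∈ rules K → Q r
rule-property K Q f r m with All.lookup (rules-sound K) m
... | _ , _ , _ , ir , refl = f ir

source-WF : ∀ n → WFForm 4 (tape n)
source-WF zero    = tt , tt , tt , tt , refl
source-WF (suc n) = tt , tt , source-WF n

source-preds : ∀ n → predsF 4 (tape n) ≡ toPS (state 0) ∷ []
source-preds zero    = refl
source-preds (suc n) = source-preds n

-- The left-hand side never reaches the comparing predicates, so connectedness is demanded of the
-- `state` rules alone.
source-states : ∀ K n {p} → InP 4 (rules K) (source n) p → Σ ℕ λ q → p ≡ toPS (state q)
source-states K n (base m) with subst (_ ∈_) (source-preds n) m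
... | here e = 0 , e
source-states K n (step r i m refl q∈) with source-states K n i | All.lookup (rules-sound K) m
... | q , e | P , c , calls , ir , refl with refl ← toPS-injective {P} {state q} e with ir | q∈
...   | transition {q' = q'} _ _ | here e' = q' , e'
...   | final _ | ()

in-fragment : ∀ K n → InFragment 4 (instance-of K n)
in-fragment K n =
  (All.tabulate (rule-property K (WFRule 4) well-formed _) , (tt , tt , source-WF n) , refl) ,
  (λ r m _ → progresses r m) , (λ r m _ → progresses r m) , connects ,
  (λ r m _ → establishes r m) , (λ r m _ → establishes r m)
  where
  progresses : ∀ r → r ∈ rules K → Progressing 4 r
  progresses = rule-property K (Progressing 4) λ {P} {c} {calls} _ → progressing P c calls

  establishes : ∀ r → r ∈ rules K → Established 4 (rules K) r
  establishes = rule-property K (Established 4 (rules K)) (established K)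

  connects : For 4 (Connected 4) (rules K) (source n)
  connects r m i with source-states K n i | All.lookup (rules-sound K) m
  ... | q , e | P , c , calls , ir , refl with refl ← toPS-injective {P} {state q} e = connected ir

-- Self-reference

open Problem

-- Opaque, since conversion checking would otherwise unfold iterated exponentials.
opaque
  pair : ℕ → ℕ → ℕ
  pair x y = ⟪ x , y ⟫

  pair-evaluates : ∀ {n} {f g : PR n} {xs x y} → f [ xs ]⇓ x → g [ xs ]⇓ y →
                   ⟪ f , g ⟫ᶠ [ xs ]⇓ pair x y
  pair-evaluates f g = ⇓comp (⇓∷ f (⇓∷ g ⇓[])) (pair-computes _ _)

-- The code of `emit` as a function of the code `y` of its continuation, with `a` and `b` the codes
-- of the points-to atom and the equation. The tags are 3 for `ex` and 1 for `∗`; the bound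
-- variables are 1 and 0.
encEmit : ℕ → ℕ → ℕ → ℕ
encEmit a b y = pair 3 (pair 1 (pair 1 (pair a (pair 3 (pair 0 (pair 1 (pair b y)))))))

emitᶠ : ∀ {n} → ℕ → ℕ → PR n → PR n
emitᶠ a b f = ⟪ constᶠ 3 , ⟪ constᶠ 1 , ⟪ constᶠ 1 , ⟪ constᶠ a ,
             ⟪ constᶠ 3 , ⟪ constᶠ 0 , ⟪ constᶠ 1 , ⟪ constᶠ b , f ⟫ᶠ ⟫ᶠ ⟫ᶠ ⟫ᶠ ⟫ᶠ ⟫ᶠ ⟫ᶠ ⟫ᶠ

emit-evaluates : ∀ {n} a b {f : PR n} {xs y} → f [ xs ]⇓ y → emitᶠ a b f [ xs ]⇓ encEmit a b y
emit-evaluates a b f =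
  pair-evaluates (const-computes 3 _) (pair-evaluates (const-computes 1 _)
  (pair-evaluates (const-computes 1 _) (pair-evaluates (const-computes a _)
  (pair-evaluates (const-computes 3 _) (pair-evaluates (const-computes 0 _)
  (pair-evaluates (const-computes 1 _) (pair-evaluates (const-computes b _) f)))))))

opaque
  unfolding pair

  code : Form 4 → ℕ
  code = encForm 4

  code-ex : ∀ x φ → code (ex x φ) ≡ pair 3 (pair x (code φ))
  code-ex x φ = refl

  code-∗ : ∀ φ ψ → code (φ ∗ ψ) ≡ pair 1 (pair (code φ) (code ψ))
  code-∗ φ ψ = refl

  codeSID : SID 4 → ℕ
  codeSID R = encℕs (map (encRule 4) R)

  codeProblem : Problem 4 → ℕ
  codeProblem = encProblem 4

  codeProblem-≡ : ∀ P → codeProblem P ≡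
                  pair (code (lhs P)) (pair (code (rhs P)) (codeSID (sid P)))
  codeProblem-≡ P = refl

  -- `codeProblem` is convertible to `encProblem` only inside this block, so the hypothesis on `e`
  -- is carried over here.
  decides-code : ∀ {e} → DecidesFragment 4 e → ∀ P → InFragment 4 P →
    (Valid 4 P → e [ codeProblem P ∷ᵥ []ᵥ ]⇓ 1) × (¬ Valid 4 P → e [ codeProblem P ∷ᵥ []ᵥ ]⇓ 0)
  decides-code decides = decides

code-emit : ∀ φ₁ φ₂ ψ → code (ex 1 (φ₁ ∗ ex 0 (φ₂ ∗ ψ))) ≡ encEmit (code φ₁) (code φ₂) (code ψ)
code-emit φ₁ φ₂ ψ = trans (code-ex 1 _) (cong (λ y → pair 3 (pair 1 y))
  (trans (code-∗ φ₁ _) (cong (λ y → pair 1 (pair (code φ₁) y))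
  (trans (code-ex 0 _) (cong (λ y → pair 3 (pair 0 y)) (code-∗ φ₂ ψ))))))

module _ (a b c d : ℕ) where

  encSource : ℕ → ℕ
  encSource zero    = c
  encSource (suc n) = encEmit a b (encSource n)

  sourceᶠ : PR 1
  sourceᶠ = recᶠ (constᶠ c) (emitᶠ a b (projᶠ (fsuc fzero)))

  source-evaluates : ∀ n → sourceᶠ [ n ∷ᵥ []ᵥ ]⇓ encSource n
  source-evaluates zero    = ⇓rec0 (const-computes c []ᵥ)
  source-evaluates (suc n) = ⇓recS (source-evaluates n) (emit-evaluates a b ⇓proj)

  -- The argument is used twice: as the input described by the left-hand side, and as the finished
  -- code of all that follows the left-hand side in the problem.
  selfᶠ : PR 1
  selfᶠ = ⟪ emitᶠ d b sourceᶠ , projᶠ fzero ⟫ᶠ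

  self-evaluates : ∀ n → selfᶠ [ n ∷ᵥ []ᵥ ]⇓ pair (encEmit d b (encSource n)) n
  self-evaluates n = pair-evaluates (emit-evaluates d b (source-evaluates n)) ⇓proj

cellForm : Token → Form 4
cellForm t = atom (0 ↦ fields (1 ▹ t))

stepForm : Form 4
stepForm = atom (0 ≈ 1)

encTape : ℕ → ℕ
encTape = encSource (code (cellForm ⟨ put one ⟩)) (code stepForm) (code (tape 0)) (code (cellForm end))

code-tape : ∀ n → code (tape n) ≡ encTape n
code-tape zero    = refl
code-tape (suc n) = trans (code-emit (cellForm ⟨ put one ⟩) stepForm (tape n))
  (cong (encEmit (code (cellForm ⟨ put one ⟩)) (code stepForm)) (code-tape n))

diagonalᶠ : PR 1
diagonalᶠ = selfᶠ (code (cellForm ⟨ put one ⟩)) (code stepForm) (code (tape 0)) (code (cellForm end))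

-- The part of the encoding independent of the input. It includes the right-hand side because it has
-- to be the whole second component of the outermost pair.
codeNumber : Code → ℕ
codeNumber K = pair (code target) (codeSID (rules K))

code-instance : ∀ K n → codeProblem (instance-of K n) ≡
  pair (encEmit (code (cellForm end)) (code stepForm) (encTape n)) (codeNumber K)
code-instance K n = trans (codeProblem-≡ (instance-of K n)) (cong (λ x → pair x (codeNumber K))
  (trans (code-emit (cellForm end) stepForm (tape n))
         (cong (encEmit (code (cellForm end)) (code stepForm)) (code-tape n))))

diagonal-evaluates : ∀ K → diagonalᶠ [ codeNumber K ∷ᵥ []ᵥ ]⇓
                     codeProblem (instance-of K (codeNumber K))
diagonal-evaluates K = subst (λ y → diagonalᶠ [ codeNumber K ∷ᵥ []ᵥ ]⇓ y)
  (sym (code-instance K (codeNumber K))) (self-evaluates _ _ _ _ (codeNumber K))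

theorem2 : Σ ℕ λ κ → ¬ Σ (PR 1) λ e → DecidesFragment κ e
theorem2 = 4 , λ (e , decides) →
  -- There is no circularity: `d` is built from `e` alone, `K` from `d`, and the number `t` of `K`
  -- is supplied to `d` only as its argument.
  let d = compᶠ e (diagonalᶠ ∷ᵥ []ᵥ)
      K = acceptor d
      t = codeNumber K

      accepts , rejects = decides-code decides (instance-of K t) (in-fragment K t)

      run : ∀ {y} → e [ codeProblem (instance-of K t) ∷ᵥ []ᵥ ]⇓ y → d [ t ∷ᵥ []ᵥ ]⇓ y
      run = ⇓comp (⇓∷ (diagonal-evaluates K) ⇓[])

      -- If the problem were valid, `e` would answer 1 and `K` would accept `t`, which makes it
      -- invalid. Hence `e` answers 0 and `K` does not accept `t`, which makes the problem valid
      -- after all.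
      ¬valid : ¬ Valid 4 (instance-of K t)
      ¬valid v = let w , path , good = accepted-word d (run (accepts v)) in invalid K t path good v
  in ¬valid (valid K t (no-accepted-word d (run (rejects ¬valid))))
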